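{- For $n\in\mathbb N$, $n\ge 1$, and $t\in\mathbb R$ let $b_n(t)=e^{t/2}e^{ -\pi n^2e^{2t}}$, and let $$\phi_n(t)=2\bigl(2\pi^2n^4e^{9t/2}-3\pi n^2e^{5t/2}\bigr)e^{ -\pi n^2e^{2t}} .$$ Then, for $t\ge0$, $$\phi_n(t)=\left(\frac{\partial^2}{\partial t^2}-\frac14\right)\left(e^{t/2}e^{ -\pi n^2e^{2t}}\right).$$ Equivalently, with $v=2t\in\mathbb R$, $B_n(v)=e^{v/4}e^{ -\pi n^2e^{v}}$ and $M=4\partial_v^2-\frac14$, one has, for $v\ge0$, $$\phi_n(v/2)=M B_n(v).$$
   Context: The functions $\phi_n$ are the theta modes of the Riemann kernel $\Phi(t)=\sum_{n\ge1}\phi_n(t)$, $t\ge0$. -}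

module Defs where

open import Level using (_⊔_) renaming (suc to lsuc)
open import Algebra.Core using (Op₁; Op₂)
open import Algebra.Bundles using (CommutativeRing; Semiring)
open import Algebra.Apartness.Bundles using (HeytingField)
open import Algebra.Apartness.Structures using (IsHeytingField)
import Algebra.Definitions.RawSemiring as RawSemiringDefinitions
open import Data.Nat.Base as ℕ using (ℕ; zero; suc; NonZero; _!)
import Data.Nat.Properties as ℕ
open import Data.Integer.Base as ℤ using (ℤ; +_; -[1+_])
import Data.Integer.Properties as ℤ
open import Data.Maybe.Base using (Maybe; just; nothing)
open import Data.Product.Base using (∃-syntax; _×_; _,_; proj₁; proj₂)
open import Data.Sum.Base using (_⊎_; inj₁; inj₂)
open import Data.Empty using (⊥-elim)
open import Relation.Nullary using (¬_; yes; no)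
open import Relation.Binary.Core using (Rel)
open import Relation.Binary.Structures using (IsStrictPartialOrder)
open import Relation.Binary.PropositionalEquality as ≡ using (_≡_)

-- The real numbers, axiomatised as a Cauchy-complete Archimedean ordered field (classically
-- unique up to isomorphism).  The order is not assumed decidable, so the Cauchy reals of
-- constructive analysis are a model as well: x # y is the positive form of x ≠ y, and x ≤ y
-- is the negation of y < x.

record RealNumbers c ℓ₁ ℓ₂ : Set (lsuc (c ⊔ ℓ₁ ⊔ ℓ₂)) where
  infix  8 -_
  infixl 7 _*_
  infixl 6 _+_
  infix  4 _≈_ _<_ _≤_ _#_ ∣_∣<_
  field
    Carrier : Set c
    _≈_     : Rel Carrier ℓ₁
    _<_     : Rel Carrier ℓ₂
    _+_     : Op₂ Carrier
    _*_     : Op₂ Carrier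
    -_      : Op₁ Carrier
    0#      : Carrier
    1#      : Carrier

  _#_ : Rel Carrier ℓ₂
  x # y = (x < y) ⊎ (y < x)

  field
    isHeytingField       : IsHeytingField _≈_ _#_ _+_ _*_ -_ 0# 1#
    isStrictPartialOrder : IsStrictPartialOrder _≈_ _<_
    +-monoˡ-<            : ∀ z {x y} → x < y → x + z < y + z
    *-pos                : ∀ {x y} → 0# < x → 0# < y → 0# < x * y

  heytingField : HeytingField c ℓ₁ ℓ₂
  heytingField = record { isHeytingField = isHeytingField }

  open HeytingField heytingField public
    hiding (Carrier; _≈_; _#_; _+_; _*_; -_; 0#; 1#; isHeytingField)

  open IsStrictPartialOrder isStrictPartialOrder public
    using (<-respʳ-≈; <-respˡ-≈)
    renaming (irrefl to <-irrefl; trans to <-trans; asym to <-asym)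

  commutativeRing : CommutativeRing c ℓ₁
  commutativeRing = record { isCommutativeRing = isCommutativeRing }

  open CommutativeRing commutativeRing public
    using (semiring; ring)

  open RawSemiringDefinitions (Semiring.rawSemiring semiring) public
    using (_^_)
    renaming (_×_ to _·_)

  fromℕ : ℕ → Carrier
  fromℕ n = n · 1#

  _≤_ : Rel Carrier ℓ₂
  x ≤ y = ¬ (y < x)

  ∣_∣<_ : Rel Carrier ℓ₂
  ∣ x ∣< ε = (- ε < x) × (x < ε)

  IsCauchy : (ℕ → Carrier) → Set (c ⊔ ℓ₂)
  IsCauchy s = ∀ ε → 0# < ε →
    ∃[ N ] (∀ m n → N ℕ.≤ m → N ℕ.≤ n → ∣ s m - s n ∣< ε)

  _ConvergesTo_ : (ℕ → Carrier) → Carrier → Set (c ⊔ ℓ₂)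
  s ConvergesTo L = ∀ ε → 0# < ε →
    ∃[ N ] (∀ n → N ℕ.≤ n → ∣ s n - L ∣< ε)

  field
    archimedean : ∀ x → ∃[ n ] x < fromℕ n
    complete    : ∀ s → IsCauchy s → ∃[ L ] s ConvergesTo L

  lim : ∀ s → IsCauchy s → Carrier
  lim s s-cauchy = proj₁ (complete s s-cauchy)

module OrderedFieldProperties {c ℓ₁ ℓ₂} (ℝ : RealNumbers c ℓ₁ ℓ₂) where

  open RealNumbers ℝ
  open import Algebra.Properties.Ring ring
  open import Algebra.Properties.Semiring.Mult semiring
    using (×-homo-+; ×1-homo-*)
  open import Algebra.Solver.Ring.AlmostCommutativeRing
    using (_-Raw-AlmostCommutative⟶_; fromCommutativeRing)
  open import Relation.Binary.Reasoning.Setoid setoid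

  fromℤ : ℤ → Carrier
  fromℤ (+ n)    = fromℕ n
  fromℤ -[1+ n ] = - fromℕ (suc n)

  private
    x≈x-0 : ∀ x → x ≈ x - 0#
    x≈x-0 x = sym (trans (+-congˡ -0#≈0#) (+-identityʳ x))

    1+x-1+y : ∀ x y → x - y ≈ (1# + x) - (1# + y)
    1+x-1+y x y = sym (begin
      (1# + x) - (1# + y)      ≈⟨ +-cong (+-comm 1# x) (-‿anti-homo-+ 1# y) ⟩
      (x + 1#) + (- y - 1#)    ≈⟨ +-congˡ (+-comm (- y) (- 1#)) ⟩
      (x + 1#) + (- 1# - y)    ≈⟨ +-assoc x 1# (- 1# - y) ⟩
      x + (1# + (- 1# - y))    ≈⟨ +-congˡ (+-assoc 1# (- 1#) (- y)) ⟨
      x + ((1# - 1#) - y)      ≈⟨ +-congˡ (+-congʳ (-‿inverseʳ 1#)) ⟩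
      x + (0# - y)             ≈⟨ +-congˡ (+-identityˡ (- y)) ⟩
      x - y                    ∎)

    fromℤ-⊖ : ∀ m n → fromℤ (m ℤ.⊖ n) ≈ fromℕ m - fromℕ n
    fromℤ-⊖ zero    zero    = x≈x-0 0#
    fromℤ-⊖ (suc m) zero    = x≈x-0 _
    fromℤ-⊖ zero    (suc n) = sym (+-identityˡ _)
    fromℤ-⊖ (suc m) (suc n) rewrite ℤ.[1+m]⊖[1+n]≡m⊖n m n =
      trans (fromℤ-⊖ m n) (1+x-1+y (fromℕ m) (fromℕ n))

    fromℤ-+ : ∀ i j → fromℤ (i ℤ.+ j) ≈ fromℤ i + fromℤ j
    fromℤ-+ (+ m)    (+ n)    = ×-homo-+ 1# m n
    fromℤ-+ (+ m)    -[1+ n ] = fromℤ-⊖ m (suc n)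
    fromℤ-+ -[1+ m ] (+ n)    = trans (fromℤ-⊖ n (suc m)) (+-comm _ _)
    fromℤ-+ -[1+ m ] -[1+ n ] = begin
      - fromℕ (2 ℕ.+ (m ℕ.+ n))             ≡⟨ ≡.cong (λ k → - fromℕ (suc k)) (≡.sym (ℕ.+-suc m n)) ⟩
      - fromℕ (suc m ℕ.+ suc n)             ≈⟨ -‿cong (×-homo-+ 1# (suc m) (suc n)) ⟩
      - (fromℕ (suc m) + fromℕ (suc n))     ≈⟨ -‿anti-homo-+ _ _ ⟩
      - fromℕ (suc n) + - fromℕ (suc m)     ≈⟨ +-comm _ _ ⟩
      - fromℕ (suc m) + - fromℕ (suc n)     ∎

    fromℤ-neg : ∀ i → fromℤ (ℤ.- i) ≈ - fromℤ i
    fromℤ-neg (+ zero)  = sym -0#≈0#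
    fromℤ-neg (+ suc n) = refl
    fromℤ-neg -[1+ n ]  = sym (-‿involutive _)

    fromℤ-*⁺ : ∀ m j → fromℤ (+ m ℤ.* j) ≈ fromℕ m * fromℤ j
    fromℤ-*⁺ m (+ n) rewrite ≡.sym (ℤ.pos-* m n) = ×1-homo-* m n
    fromℤ-*⁺ m -[1+ n ] = begin
      fromℤ (+ m ℤ.* -[1+ n ])        ≡⟨ ≡.cong fromℤ (≡.sym (ℤ.neg-distribʳ-* (+ m) (+ suc n))) ⟩
      fromℤ (ℤ.- (+ m ℤ.* + suc n))   ≈⟨ fromℤ-neg (+ m ℤ.* + suc n) ⟩
      - fromℤ (+ m ℤ.* + suc n)       ≈⟨ -‿cong (fromℤ-*⁺ m (+ suc n)) ⟩
      - (fromℕ m * fromℕ (suc n))     ≈⟨ -‿distribʳ-* _ _ ⟩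
      fromℕ m * - fromℕ (suc n)       ∎

    fromℤ-* : ∀ i j → fromℤ (i ℤ.* j) ≈ fromℤ i * fromℤ j
    fromℤ-* (+ m)    j = fromℤ-*⁺ m j
    fromℤ-* -[1+ m ] j = begin
      fromℤ (-[1+ m ] ℤ.* j)          ≡⟨ ≡.cong fromℤ (≡.sym (ℤ.neg-distribˡ-* (+ suc m) j)) ⟩
      fromℤ (ℤ.- (+ suc m ℤ.* j))     ≈⟨ fromℤ-neg (+ suc m ℤ.* j) ⟩
      - fromℤ (+ suc m ℤ.* j)         ≈⟨ -‿cong (fromℤ-*⁺ (suc m) j) ⟩
      - (fromℕ (suc m) * fromℤ j)     ≈⟨ -‿distribˡ-* _ _ ⟩
      - fromℕ (suc m) * fromℤ j       ∎

    fromℤ-morphism : ℤ.+-*-rawRing -Raw-AlmostCommutative⟶ fromCommutativeRing commutativeRing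
    fromℤ-morphism = record
      { ⟦_⟧    = fromℤ
      ; +-homo = fromℤ-+
      ; *-homo = fromℤ-*
      ; -‿homo = fromℤ-neg
      ; 0-homo = refl
      ; 1-homo = +-identityʳ 1#
      }

    coefficient≟ : ∀ i j → Maybe (fromℤ i ≈ fromℤ j)
    coefficient≟ i j with i ℤ.≟ j
    ... | yes i≡j = just (reflexive (≡.cong fromℤ i≡j))
    ... | no  _   = nothing

  open import Algebra.Solver.Ring ℤ.+-*-rawRing (fromCommutativeRing commutativeRing)
    fromℤ-morphism coefficient≟ public
    using (solve; _:+_; _:*_; _:-_; :-_; _:=_; con)

  private variable
    x y z a b ε : Carrier

  <-by : 0# < z → z ≈ y - x → x < y
  <-by {z} {y} {x} 0<z z≈y-x =
    <-respʳ-≈ (solve 2 (λ x y → (y :- x) :+ x := y) refl x y)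
      (<-respˡ-≈ (+-identityˡ x) (+-monoˡ-< x (<-respʳ-≈ z≈y-x 0<z)))

  <⇒0<- : x < y → 0# < y - x
  <⇒0<- {x} {y} x<y = <-respˡ-≈ (-‿inverseʳ x) (+-monoˡ-< (- x) x<y)

  <-cotrans : x < y → ∀ z → (x < z) ⊎ (z < y)
  <-cotrans x<y z with #-cotrans (inj₁ x<y) z
  ... | inj₁ (inj₁ x<z) = inj₁ x<z
  ... | inj₁ (inj₂ z<x) = inj₂ (<-trans z<x x<y)
  ... | inj₂ (inj₁ z<y) = inj₂ z<y
  ... | inj₂ (inj₂ y<z) = inj₁ (<-trans x<y y<z)

  <⇒≤ : x < y → x ≤ y
  <⇒≤ = <-asym

  ≈⇒≤ : x ≈ y → x ≤ y
  ≈⇒≤ x≈y = <-irrefl (sym x≈y)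

  ≤-<-trans : x ≤ y → y < z → x < z
  ≤-<-trans {x} x≤y y<z with <-cotrans y<z x
  ... | inj₁ y<x = ⊥-elim (x≤y y<x)
  ... | inj₂ x<z = x<z

  <-≤-trans : x < y → y ≤ z → x < z
  <-≤-trans {z = z} x<y y≤z with <-cotrans x<y z
  ... | inj₁ x<z = x<z
  ... | inj₂ z<y = ⊥-elim (y≤z z<y)

  ≤-trans : x ≤ y → y ≤ z → x ≤ z
  ≤-trans x≤y y≤z z<x = y≤z (<-≤-trans z<x x≤y)

  ≤-respʳ : y ≈ z → x ≤ y → x ≤ z
  ≤-respʳ y≈z x≤y z<x = x≤y (<-respˡ-≈ (sym y≈z) z<x)

  ≤-respˡ : x ≈ z → x ≤ y → z ≤ y
  ≤-respˡ x≈z x≤y y<z = x≤y (<-respʳ-≈ (sym x≈z) y<z)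

  +-monoˡ-≤ : ∀ z → x ≤ y → x + z ≤ y + z
  +-monoˡ-≤ {x} {y} z x≤y y+z<x+z = x≤y (<-by (<⇒0<- y+z<x+z)
    (solve 3 (λ x y z → (x :+ z) :- (y :+ z) := x :- y) refl x y z))

  ≤-by : 0# ≤ z → z ≈ y - x → x ≤ y
  ≤-by {z} {y} {x} 0≤z z≈y-x =
    ≤-respʳ (solve 2 (λ x y → (y :- x) :+ x := y) refl x y)
      (≤-respˡ (+-identityˡ x) (+-monoˡ-≤ x (≤-respʳ z≈y-x 0≤z)))

  ≤⇒0≤- : x ≤ y → 0# ≤ y - x
  ≤⇒0≤- {x} x≤y = ≤-respˡ (-‿inverseʳ x) (+-monoˡ-≤ (- x) x≤y)

  +-nonneg : 0# ≤ x → 0# ≤ y → 0# ≤ x + y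
  +-nonneg {x} {y} 0≤x 0≤y =
    ≤-trans 0≤y (≤-by 0≤x (solve 2 (λ x y → x := (x :+ y) :- y) refl x y))

  open import Algebra.Apartness.Properties.HeytingCommutativeRing
    (HeytingField.heytingCommutativeRing heytingField)
    using (1#0; x-0≈x; invertibleʳ⇒#)

  0<1 : 0# < 1#
  0<1 with 1#0
  ... | inj₂ 0<1 = 0<1
  ... | inj₁ 1<0 =
    <-respʳ-≈ (trans (solve 1 (λ x → (con (+ 0) :- x) :* (con (+ 0) :- x) := x :* x) refl 1#)
                     (*-identityˡ 1#))
      (*-pos (<⇒0<- 1<0) (<⇒0<- 1<0))

  fromℕ-nonneg : ∀ n → 0# ≤ fromℕ n
  fromℕ-nonneg zero    = ≈⇒≤ refl
  fromℕ-nonneg (suc n) = +-nonneg (<⇒≤ 0<1) (fromℕ-nonneg n)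

  fromℕ-pos : ∀ n → 0# < fromℕ (suc n)
  fromℕ-pos n = <-≤-trans 0<1
    (≤-by (fromℕ-nonneg n) (solve 2 (λ e x → x := (e :+ x) :- e) refl 1# (fromℕ n)))

  fromℕ-mono : ∀ {m n} → m ℕ.≤ n → fromℕ m ≤ fromℕ n
  fromℕ-mono {m} {n} m≤n = ≤-by (fromℕ-nonneg (n ℕ.∸ m)) (begin
    fromℕ (n ℕ.∸ m)                         ≈⟨ solve 2 (λ x y → x := (x :+ y) :- y) refl _ _ ⟩
    fromℕ (n ℕ.∸ m) + fromℕ m - fromℕ m     ≈⟨ +-congʳ (×-homo-+ 1# (n ℕ.∸ m) m) ⟨
    fromℕ (n ℕ.∸ m ℕ.+ m) - fromℕ m         ≡⟨ ≡.cong (λ k → fromℕ k - fromℕ m) (ℕ.m∸n+n≡m m≤n) ⟩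
    fromℕ n - fromℕ m                       ∎)

  inv : ∀ x → x # 0# → Carrier
  inv x x#0 = proj₁ (#⇒invertible x#0)

  inv-inverseʳ : ∀ x (x#0 : x # 0#) → x * inv x x#0 ≈ 1#
  inv-inverseʳ x x#0 = trans (*-congʳ (sym (x-0≈x x))) (proj₂ (proj₂ (#⇒invertible x#0)))

  factor-# : x * y # 0# → x # 0#
  factor-# {x} {y} xy#0 = invertibleʳ⇒# (y * inv (x * y) xy#0 , (begin
    (x - 0#) * (y * inv (x * y) xy#0)  ≈⟨ *-congʳ (x-0≈x x) ⟩
    x * (y * inv (x * y) xy#0)         ≈⟨ *-assoc x y _ ⟨
    x * y * inv (x * y) xy#0           ≈⟨ inv-inverseʳ (x * y) xy#0 ⟩
    1#                                 ∎))

  #∧≤⇒< : x # 0# → 0# ≤ x → 0# < x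
  #∧≤⇒< (inj₁ x<0) 0≤x = ⊥-elim (0≤x x<0)
  #∧≤⇒< (inj₂ 0<x) _   = 0<x

  *-nonneg : 0# ≤ x → 0# ≤ y → 0# ≤ x * y
  *-nonneg {x} {y} 0≤x 0≤y xy<0 = <-asym xy<0 (*-pos
    (#∧≤⇒< (factor-# (inj₁ xy<0)) 0≤x)
    (#∧≤⇒< (factor-# (inj₁ (<-respˡ-≈ (*-comm x y) xy<0))) 0≤y))

  inv-pos : ∀ {x} (0<x : 0# < x) → 0# < inv x (inj₂ 0<x)
  inv-pos {x} 0<x with factor-# {inv x (inj₂ 0<x)} {x} (inj₂ (<-respʳ-≈
                         (sym (trans (*-comm _ x) (inv-inverseʳ x (inj₂ 0<x)))) 0<1))
  ... | inj₂ 0<x⁻¹ = 0<x⁻¹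
  ... | inj₁ x⁻¹<0 = ⊥-elim (<-asym 0<1 (<-by (*-pos 0<x (<⇒0<- x⁻¹<0)) (trans
    (solve 2 (λ x y → x :* (con (+ 0) :- y) := con (+ 0) :- x :* y) refl x (inv x (inj₂ 0<x)))
    (+-congˡ (-‿cong (inv-inverseʳ x (inj₂ 0<x)))))))

  *-cancelʳ-nonneg : 0# < z → 0# ≤ x * z → 0# ≤ x
  *-cancelʳ-nonneg {z} {x} 0<z 0≤xz x<0 = 0≤xz (<-by (*-pos (<⇒0<- x<0) 0<z)
    (solve 2 (λ x z → (con (+ 0) :- x) :* z := con (+ 0) :- x :* z) refl x z))

  double-nonneg : 0# ≤ x + x → 0# ≤ x
  double-nonneg {x} 0≤x+x x<0 = 0≤x+x (<-trans
    (<-by (<⇒0<- x<0) (solve 1 (λ x → con (+ 0) :- x := x :- (x :+ x)) refl x)) x<0)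

  infixl 7 _/_
  _/_ : Carrier → (n : ℕ) → .{{NonZero n}} → Carrier
  x / suc n = x * inv (fromℕ (suc n)) (inj₂ (fromℕ-pos n))

  /-* : ∀ x n .{{_ : NonZero n}} → x / n * fromℕ n ≈ x
  /-* x (suc n) = begin
    x * inv (fromℕ (suc n)) _ * fromℕ (suc n)    ≈⟨ *-assoc x _ _ ⟩
    x * (inv (fromℕ (suc n)) _ * fromℕ (suc n))  ≈⟨ *-congˡ (*-comm _ _) ⟩
    x * (fromℕ (suc n) * inv (fromℕ (suc n)) _)  ≈⟨ *-congˡ (inv-inverseʳ _ _) ⟩
    x * 1#                                       ≈⟨ *-identityʳ x ⟩
    x                                            ∎

  /-nonneg : ∀ n .{{_ : NonZero n}} → 0# ≤ x → 0# ≤ x / n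
  /-nonneg (suc n) 0≤x = *-nonneg 0≤x (<⇒≤ (inv-pos (fromℕ-pos n)))

  *-cancelʳ-fromℕ : ∀ n .{{_ : NonZero n}} → x * fromℕ n ≈ y * fromℕ n → x ≈ y
  *-cancelʳ-fromℕ {x} {y} (suc n) xn≈yn = begin
    x                                ≈⟨ lemma x ⟩
    x * fromℕ (suc n) / suc n        ≈⟨ *-congʳ xn≈yn ⟩
    y * fromℕ (suc n) / suc n        ≈⟨ lemma y ⟨
    y                                ∎
    where
    lemma : ∀ z → z ≈ z * fromℕ (suc n) / suc n
    lemma z = sym (trans (*-assoc z _ _) (trans (*-congˡ (inv-inverseʳ _ _)) (*-identityʳ z)))

  infix 4 ∣_∣≤_
  ∣_∣≤_ : Rel Carrier ℓ₂
  ∣ x ∣≤ b = (- b ≤ x) × (x ≤ b)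

  bounds : 0# ≤ b + x → 0# ≤ b - x → ∣ x ∣≤ b
  bounds {b} {x} p q =
    ≤-by p (solve 2 (λ b x → b :+ x := x :- (:- b)) refl b x) , ≤-by q refl

  lower : ∣ x ∣≤ b → 0# ≤ b + x
  lower {x} {b} p =
    ≤-respʳ (solve 2 (λ b x → x :- (:- b) := b :+ x) refl b x) (≤⇒0≤- (proj₁ p))

  upper : ∣ x ∣≤ b → 0# ≤ b - x
  upper p = ≤⇒0≤- (proj₂ p)

  ∣∣≤-nonneg : ∣ x ∣≤ b → 0# ≤ b
  ∣∣≤-nonneg {x} {b} p = double-nonneg (≤-respʳ
    (solve 2 (λ b x → (b :+ x) :+ (b :- x) := b :+ b) refl b x)
    (+-nonneg (lower p) (upper p)))

  ∣∣≤-reflexive : 0# ≤ x → ∣ x ∣≤ x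
  ∣∣≤-reflexive {x} 0≤x = bounds (+-nonneg 0≤x 0≤x) (≈⇒≤ (sym (-‿inverseʳ x)))

  ∣∣≤-resp : x ≈ y → ∣ x ∣≤ b → ∣ y ∣≤ b
  ∣∣≤-resp x≈y (p , q) = ≤-respʳ x≈y p , ≤-respˡ x≈y q

  ∣∣≤-weaken : a ≤ b → ∣ x ∣≤ a → ∣ x ∣≤ b
  ∣∣≤-weaken {a} {b} {x} a≤b (p , q) =
    ≤-trans (≤-by (≤⇒0≤- a≤b) (solve 2 (λ a b → b :- a := :- a :- (:- b)) refl a b)) p ,
    ≤-trans q a≤b

  ∣∣≤-neg : ∣ x ∣≤ b → ∣ - x ∣≤ b
  ∣∣≤-neg {x} {b} p = bounds (upper p)
    (≤-respʳ (solve 2 (λ b x → b :+ x := b :- (:- x)) refl b x) (lower p))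

  ∣∣≤-+ : ∣ x ∣≤ a → ∣ y ∣≤ b → ∣ x + y ∣≤ a + b
  ∣∣≤-+ {x} {a} {y} {b} p q = bounds
    (≤-respʳ (solve 4 (λ x a y b → (a :+ x) :+ (b :+ y) := (a :+ b) :+ (x :+ y)) refl x a y b)
      (+-nonneg (lower p) (lower q)))
    (≤-respʳ (solve 4 (λ x a y b → (a :- x) :+ (b :- y) := (a :+ b) :- (x :+ y)) refl x a y b)
      (+-nonneg (upper p) (upper q)))

  ∣∣≤-* : ∣ x ∣≤ a → ∣ y ∣≤ b → ∣ x * y ∣≤ a * b
  ∣∣≤-* {x} {a} {y} {b} p q = bounds
    (double-nonneg (≤-respʳ
      (solve 4 (λ x a y b → (a :+ x) :* (b :+ y) :+ (a :- x) :* (b :- y)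
                         := (a :* b :+ x :* y) :+ (a :* b :+ x :* y)) refl x a y b)
      (+-nonneg (*-nonneg (lower p) (lower q)) (*-nonneg (upper p) (upper q)))))
    (double-nonneg (≤-respʳ
      (solve 4 (λ x a y b → (a :- x) :* (b :+ y) :+ (a :+ x) :* (b :- y)
                         := (a :* b :- x :* y) :+ (a :* b :- x :* y)) refl x a y b)
      (+-nonneg (*-nonneg (upper p) (lower q)) (*-nonneg (lower p) (upper q)))))

  ∣∣≤⇒∣∣< : b < ε → ∣ x ∣≤ b → ∣ x ∣< ε
  ∣∣≤⇒∣∣< {b} {ε} b<ε (p , q) =
    <-≤-trans (<-by (<⇒0<- b<ε) (solve 2 (λ b e → e :- b := :- b :- (:- e)) refl b ε)) p ,
    ≤-<-trans q b<ε

  cauchy-criterion : ∀ (s r : ℕ → Carrier) D n₀ →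
    (∀ n d → n₀ ℕ.≤ n → ∣ s (d ℕ.+ n) - s n ∣≤ r n) →
    (∀ n → n₀ ℕ.≤ n → r n * fromℕ n ≤ D) →
    IsCauchy s
  cauchy-criterion s r D n₀ tail rate ε 0<ε = N , close
    where
    ε⁻¹ = inv ε (inj₂ 0<ε)
    N₁  = proj₁ (archimedean (D * ε⁻¹))
    N   = suc (n₀ ℕ.+ N₁)

    D<N₁ε : D < fromℕ N₁ * ε
    D<N₁ε = <-by (*-pos (<⇒0<- (proj₂ (archimedean (D * ε⁻¹)))) 0<ε) (begin
      (fromℕ N₁ - D * ε⁻¹) * ε       ≈⟨ solve 4 (λ n d i e → (n :- d :* i) :* e := n :* e :- d :* (e :* i)) refl _ D ε⁻¹ ε ⟩
      fromℕ N₁ * ε - D * (ε * ε⁻¹)   ≈⟨ +-congˡ (-‿cong (*-congˡ (inv-inverseʳ ε _))) ⟩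
      fromℕ N₁ * ε - D * 1#          ≈⟨ +-congˡ (-‿cong (*-identityʳ D)) ⟩
      fromℕ N₁ * ε - D               ∎)

    n₀≤ : ∀ {n} → N ℕ.≤ n → n₀ ℕ.≤ n
    n₀≤ N≤n = ℕ.≤-trans (ℕ.m≤n⇒m≤1+n (ℕ.m≤m+n n₀ N₁)) N≤n

    N₁≤ : ∀ {n} → N ℕ.≤ n → N₁ ℕ.≤ n
    N₁≤ N≤n = ℕ.≤-trans (ℕ.m≤n⇒m≤1+n (ℕ.m≤n+m N₁ n₀)) N≤n

    small : ∀ n → N ℕ.≤ n → r n < ε
    small (suc k) N≤n = <-by (*-pos (<⇒0<- rn<nε) (inv-pos (fromℕ-pos k))) (begin
      (n * ε - r (suc k) * n) * n⁻¹     ≈⟨ solve 4 (λ n e r i → (n :* e :- r :* n) :* i := (e :- r) :* (n :* i)) refl n ε (r (suc k)) n⁻¹ ⟩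
      (ε - r (suc k)) * (n * n⁻¹)       ≈⟨ *-congˡ (inv-inverseʳ n _) ⟩
      (ε - r (suc k)) * 1#              ≈⟨ *-identityʳ _ ⟩
      ε - r (suc k)                     ∎)
      where
      n   = fromℕ (suc k)
      n⁻¹ = inv n (inj₂ (fromℕ-pos k))
      rn<nε : r (suc k) * n < n * ε
      rn<nε = <-≤-trans (≤-<-trans (rate (suc k) (n₀≤ N≤n)) D<N₁ε)
        (≤-by (*-nonneg (≤⇒0≤- (fromℕ-mono (N₁≤ N≤n))) (<⇒≤ 0<ε))
          (solve 3 (λ n m e → (n :- m) :* e := n :* e :- m :* e) refl n (fromℕ N₁) ε))

    near : ∀ {m n} → n ℕ.≤ m → N ℕ.≤ n → ∣ s m - s n ∣≤ r n
    near {m} {n} n≤m N≤n = ≡.subst (λ k → ∣ s k - s n ∣≤ r n) (ℕ.m∸n+n≡m n≤m)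
      (tail n (m ℕ.∸ n) (n₀≤ N≤n))

    close : ∀ m n → N ℕ.≤ m → N ℕ.≤ n → ∣ s m - s n ∣< ε
    close m n N≤m N≤n with ℕ.≤-total n m
    ... | inj₁ n≤m = ∣∣≤⇒∣∣< (small n N≤n) (near n≤m N≤n)
    ... | inj₂ m≤n = ∣∣≤⇒∣∣< (small m N≤m)
      (∣∣≤-resp (solve 2 (λ x y → :- (x :- y) := y :- x) refl (s n) (s m)) (∣∣≤-neg (near m≤n N≤m)))

module Analysis {c ℓ₁ ℓ₂} (ℝ : RealNumbers c ℓ₁ ℓ₂) where

  open RealNumbers ℝ
  open OrderedFieldProperties ℝ hiding (inv; _/_)
  open OrderedFieldProperties ℝ public using (inv; _/_)
  open import Algebra.Properties.Ring ring using (-1*x≈-x)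
  open import Algebra.Properties.Semiring.Mult semiring using (×-homo-+; ×1-homo-*)
  open import Relation.Binary.Reasoning.Setoid setoid

  partialSum : (ℕ → Carrier) → ℕ → Carrier
  partialSum f zero    = 0#
  partialSum f (suc n) = partialSum f n + f n

  expTerm : Carrier → ℕ → Carrier
  expTerm x k = (x ^ k / k !) {{k ℕ.!≢0}}

  expTerm-suc : ∀ x k → expTerm x (suc k) * fromℕ (suc k) ≈ x * expTerm x k
  expTerm-suc x k = *-cancelʳ-fromℕ (k !) {{k ℕ.!≢0}} (begin
    expTerm x (suc k) * fromℕ (suc k) * fromℕ (k !)    ≈⟨ *-assoc _ _ _ ⟩
    expTerm x (suc k) * (fromℕ (suc k) * fromℕ (k !))  ≈⟨ *-congˡ (×1-homo-* (suc k) (k !)) ⟨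
    expTerm x (suc k) * fromℕ (suc k !)                ≈⟨ /-* (x ^ suc k) (suc k !) {{suc k ℕ.!≢0}} ⟩
    x * x ^ k                                          ≈⟨ *-congˡ (/-* (x ^ k) (k !) {{k ℕ.!≢0}}) ⟨
    x * (expTerm x k * fromℕ (k !))                    ≈⟨ *-assoc _ _ _ ⟨
    x * expTerm x k * fromℕ (k !)                      ∎)

  ^-bound : ∀ {x B} → ∣ x ∣≤ B → ∀ k → ∣ x ^ k ∣≤ B ^ k
  ^-bound p zero    = ∣∣≤-reflexive (<⇒≤ 0<1)
  ^-bound p (suc k) = ∣∣≤-* p (^-bound p k)

  /-bound : ∀ {x B} n .{{_ : NonZero n}} → ∣ x ∣≤ B → ∣ x / n ∣≤ B / n
  /-bound (suc n) p = ∣∣≤-* p (∣∣≤-reflexive (<⇒≤ (inv-pos (fromℕ-pos n))))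

  exp-cauchy : ∀ x → IsCauchy (partialSum (expTerm x))
  exp-cauchy x = cauchy-criterion S (λ n → u n + u n) (D + D) N₀ tail rate
    where
    b₁ = proj₁ (archimedean x)
    b₂ = proj₁ (archimedean (- x))
    b  = b₁ ℕ.+ b₂
    N₀ = b ℕ.+ b
    B  = fromℕ b
    S  = partialSum (expTerm x)
    u  = expTerm B
    D  = u N₀ * fromℕ N₀

    ∣x∣≤B : ∣ x ∣≤ B
    ∣x∣≤B =
      ≤-by (≤⇒0≤- (≤-trans (<⇒≤ (proj₂ (archimedean (- x)))) (fromℕ-mono (ℕ.m≤n+m b₂ b₁))))
        (solve 2 (λ x b → b :- (:- x) := x :- (:- b)) refl x B) ,
      ≤-trans (<⇒≤ (proj₂ (archimedean x))) (fromℕ-mono (ℕ.m≤m+n b₁ b₂))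

    term≤u : ∀ k → ∣ expTerm x k ∣≤ u k
    term≤u k = /-bound (k !) {{k ℕ.!≢0}} (^-bound ∣x∣≤B k)

    0≤u : ∀ k → 0# ≤ u k
    0≤u k = ∣∣≤-nonneg (term≤u k)

    halving : ∀ k → N₀ ℕ.≤ k → u (suc k) + u (suc k) ≤ u k
    halving k N₀≤k = ≤-by (*-cancelʳ-nonneg (fromℕ-pos k)
      (≤-respʳ (begin
        (fromℕ (suc k) - fromℕ N₀) * u k                    ≈⟨ *-congʳ (+-congˡ (-‿cong (×-homo-+ 1# b b))) ⟩
        (K - (B + B)) * u k                                 ≈⟨ solve 3 (λ K B u → (K :- (B :+ B)) :* u := u :* K :- (B :* u :+ B :* u)) refl K B (u k) ⟩
        u k * K - (B * u k + B * u k)                       ≈⟨ +-congˡ (-‿cong (+-cong (expTerm-suc B k) (expTerm-suc B k))) ⟨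
        u k * K - (u (suc k) * K + u (suc k) * K)           ≈⟨ solve 3 (λ K u v → u :* K :- (v :* K :+ v :* K) := (u :- (v :+ v)) :* K) refl K (u k) (u (suc k)) ⟩
        (u k - (u (suc k) + u (suc k))) * K                 ∎)
      (*-nonneg (≤⇒0≤- (fromℕ-mono (ℕ.m≤n⇒m≤1+n N₀≤k))) (0≤u k)))) refl
      where K = fromℕ (suc k)

    tail′ : ∀ n d → N₀ ℕ.≤ n → ∣ S (d ℕ.+ n) - S n ∣≤ (u n + u n) - (u (d ℕ.+ n) + u (d ℕ.+ n))
    tail′ n zero    N₀≤n = ∣∣≤-resp (sym (-‿inverseʳ (S n)))
      (∣∣≤-weaken (≈⇒≤ (sym (-‿inverseʳ (u n + u n)))) (∣∣≤-reflexive (≈⇒≤ refl)))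
    tail′ n (suc d) N₀≤n = ∣∣≤-weaken
      (≤-by (≤⇒0≤- (halving (d ℕ.+ n) (ℕ.≤-trans N₀≤n (ℕ.m≤n+m n d))))
        (solve 3 (λ a v w → v :- (w :+ w) := (a :- (w :+ w)) :- ((a :- (v :+ v)) :+ v)) refl
          (u n + u n) (u (d ℕ.+ n)) (u (suc d ℕ.+ n))))
      (∣∣≤-resp (solve 3 (λ s t e → (s :- t) :+ e := (s :+ e) :- t) refl (S (d ℕ.+ n)) (S n) (expTerm x (d ℕ.+ n)))
        (∣∣≤-+ (tail′ n d N₀≤n) (term≤u (d ℕ.+ n))))

    tail : ∀ n d → N₀ ℕ.≤ n → ∣ S (d ℕ.+ n) - S n ∣≤ u n + u n
    tail n d N₀≤n = ∣∣≤-weaken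
      (≤-by (+-nonneg (0≤u (d ℕ.+ n)) (0≤u (d ℕ.+ n)))
        (solve 2 (λ a v → v := a :- (a :- v)) refl (u n + u n) (u (d ℕ.+ n) + u (d ℕ.+ n))))
      (tail′ n d N₀≤n)

    rate₀ : ∀ d → u (d ℕ.+ N₀) * fromℕ (d ℕ.+ N₀) ≤ D
    rate₀ zero    = ≈⇒≤ refl
    rate₀ (suc d) = ≤-trans
      (≤-respˡ (sym (expTerm-suc B (d ℕ.+ N₀)))
        (≤-by (*-nonneg (0≤u (d ℕ.+ N₀)) (≤⇒0≤- (fromℕ-mono b≤)))
          (solve 3 (λ u n B → u :* (n :- B) := u :* n :- B :* u) refl (u (d ℕ.+ N₀)) (fromℕ (d ℕ.+ N₀)) B)))
      (rate₀ d)
      where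
      b≤ : b ℕ.≤ d ℕ.+ N₀
      b≤ = ℕ.≤-trans (ℕ.m≤m+n b b) (ℕ.m≤n+m N₀ d)

    rate : ∀ n → N₀ ℕ.≤ n → (u n + u n) * fromℕ n ≤ D + D
    rate n N₀≤n = ≡.subst (λ k → (u k + u k) * fromℕ k ≤ D + D) (ℕ.m∸n+n≡m N₀≤n)
      (≤-by (+-nonneg (≤⇒0≤- (rate₀ d)) (≤⇒0≤- (rate₀ d)))
        (solve 3 (λ D u n → (D :- u :* n) :+ (D :- u :* n) := (D :+ D) :- (u :+ u) :* n) refl
          D (u (d ℕ.+ N₀)) (fromℕ (d ℕ.+ N₀))))
      where d = n ℕ.∸ N₀

  exp : Carrier → Carrier
  exp x = lim (partialSum (expTerm x)) (exp-cauchy x)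

  -- π = 4 (1 − 1/3 + 1/5 − 1/7 + ⋯)

  leibnizTerm : ℕ → Carrier
  leibnizTerm k = (- 1#) ^ k / suc (2 ℕ.* k)

  leibniz-cauchy : IsCauchy (partialSum leibnizTerm)
  leibniz-cauchy = cauchy-criterion S a 1# 0 tail rate
    where
    S = partialSum leibnizTerm

    a : ℕ → Carrier
    a k = 1# / suc (2 ℕ.* k)

    0≤a : ∀ k → 0# ≤ a k
    0≤a k = /-nonneg (suc (2 ℕ.* k)) (<⇒≤ 0<1)

    a-decreasing : ∀ k → a (suc k) ≤ a k
    a-decreasing k = ≤-by (*-cancelʳ-nonneg (fromℕ-pos (2 ℕ.* k)) (≤-respʳ (begin
      a (suc k) * (q - p)            ≈⟨ solve 3 (λ a q p → a :* (q :- p) := a :* q :- a :* p) refl (a (suc k)) q p ⟩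
      a (suc k) * q - a (suc k) * p  ≈⟨ +-congʳ (trans (/-* 1# (suc (2 ℕ.* suc k))) (sym (/-* 1# (suc (2 ℕ.* k))))) ⟩
      a k * p - a (suc k) * p        ≈⟨ solve 3 (λ a b p → b :* p :- a :* p := (b :- a) :* p) refl (a (suc k)) (a k) p ⟩
      (a k - a (suc k)) * p          ∎)
      (*-nonneg (0≤a (suc k))
        (≤⇒0≤- (fromℕ-mono (ℕ.s≤s (ℕ.*-monoʳ-≤ 2 (ℕ.n≤1+n k)))))))) refl
      where
      p = fromℕ (suc (2 ℕ.* k))
      q = fromℕ (suc (2 ℕ.* suc k))

    -- R n d = aₙ − aₙ₊₁ + ⋯ ± aₙ₊d₋₁
    R : ℕ → ℕ → Carrier
    R n zero    = 0#
    R n (suc d) = a n - R (suc n) d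

    0≤R≤a : ∀ n d → (0# ≤ R n d) × (R n d ≤ a n)
    0≤R≤a n zero    = ≈⇒≤ refl , 0≤a n
    0≤R≤a n (suc d) =
      ≤⇒0≤- (≤-trans (proj₂ (0≤R≤a (suc n) d)) (a-decreasing n)) ,
      ≤-by (proj₁ (0≤R≤a (suc n) d)) (solve 2 (λ a r → r := a :- (a :- r)) refl (a n) (R (suc n) d))

    S-R : ∀ n d → S (d ℕ.+ n) - S n ≈ (- 1#) ^ n * R n d
    S-R n zero    = trans (-‿inverseʳ (S n)) (sym (zeroʳ _))
    S-R n (suc d) = begin
      S (suc d ℕ.+ n) - S n                  ≡⟨ ≡.cong (λ k → S k - S n) (≡.sym (ℕ.+-suc d n)) ⟩
      S (d ℕ.+ suc n) - S n                  ≈⟨ solve 3 (λ x s t → x :- s := (x :- (s :+ t)) :+ t) refl (S (d ℕ.+ suc n)) (S n) (leibnizTerm n) ⟩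
      (S (d ℕ.+ suc n) - S (suc n)) + e * i  ≈⟨ +-congʳ (S-R (suc n) d) ⟩
      - 1# * e * R (suc n) d + e * i         ≈⟨ +-cong (*-congʳ (-1*x≈-x e)) (*-congˡ (sym (*-identityˡ i))) ⟩
      - e * R (suc n) d + e * a n            ≈⟨ solve 3 (λ e r a → :- e :* r :+ e :* a := e :* (a :- r)) refl e (R (suc n) d) (a n) ⟩
      e * (a n - R (suc n) d)                ∎
      where
      e = (- 1#) ^ n
      i = inv (fromℕ (suc (2 ℕ.* n))) (inj₂ (fromℕ-pos (2 ℕ.* n)))

    ∣sign∣≤1 : ∀ n → ∣ (- 1#) ^ n ∣≤ 1#
    ∣sign∣≤1 zero    = ∣∣≤-reflexive (<⇒≤ 0<1)
    ∣sign∣≤1 (suc n) = ∣∣≤-resp (sym (-1*x≈-x _)) (∣∣≤-neg (∣sign∣≤1 n))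

    tail : ∀ n d → 0 ℕ.≤ n → ∣ S (d ℕ.+ n) - S n ∣≤ a n
    tail n d _ = ∣∣≤-resp (sym (S-R n d)) (∣∣≤-weaken
      (≤-respˡ (sym (*-identityˡ _)) (proj₂ (0≤R≤a n d)))
      (∣∣≤-* (∣sign∣≤1 n) (∣∣≤-reflexive (proj₁ (0≤R≤a n d)))))

    rate : ∀ n → 0 ℕ.≤ n → a n * fromℕ n ≤ 1#
    rate n _ = ≤-by (*-nonneg (0≤a n) (≤⇒0≤- (fromℕ-mono (ℕ.m≤n⇒m≤1+n (ℕ.m≤m+n n (n ℕ.+ 0))))))
      (trans (solve 3 (λ a q p → a :* (q :- p) := a :* q :- a :* p) refl (a n) (fromℕ (suc (2 ℕ.* n))) (fromℕ n))
        (+-congʳ (/-* 1# (suc (2 ℕ.* n)))))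

  π : Carrier
  π = fromℕ 4 * lim (partialSum leibnizTerm) leibniz-cauchy

  HasDerivativeAt : (Carrier → Carrier) → Carrier → Carrier → Set (c ⊔ ℓ₂)
  HasDerivativeAt f x L = ∀ ε → 0# < ε → ∃[ δ ] (0# < δ) ×
    (∀ h (h#0 : h # 0#) → ∣ h ∣< δ → ∣ (f (x + h) - f x) * inv h h#0 - L ∣< ε)

  HasSecondDerivativeAt : (Carrier → Carrier) → Carrier → Carrier → Set (c ⊔ ℓ₂)
  HasSecondDerivativeAt f x L =
    ∃[ f′ ] (∀ y → HasDerivativeAt f y (f′ y)) × HasDerivativeAt f′ x L

  -- "(α ∂² − β) f is defined at x, with value y."

  ⟨_∂²−_⟩_at_↦_ : Carrier → Carrier → (Carrier → Carrier) → Carrier → Carrier → Set (c ⊔ ℓ₁ ⊔ ℓ₂)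
  ⟨ α ∂²− β ⟩ f at x ↦ y = ∃[ f″ ] HasSecondDerivativeAt f x f″ × (y ≈ α * f″ - β * f x)

module ThetaModes {c ℓ₁ ℓ₂} (ℝ : RealNumbers c ℓ₁ ℓ₂) where

  open RealNumbers ℝ
  open Analysis ℝ

  b : ℕ → Carrier → Carrier
  b n t = exp (t / 2) * exp (- (π * fromℕ n ^ 2 * exp (fromℕ 2 * t)))

  φ : ℕ → Carrier → Carrier
  φ n t =
    fromℕ 2 * ( fromℕ 2 * π ^ 2 * fromℕ n ^ 4 * exp (fromℕ 9 * t / 2)
              - fromℕ 3 * π * fromℕ n ^ 2 * exp (fromℕ 5 * t / 2))
            * exp (- (π * fromℕ n ^ 2 * exp (fromℕ 2 * t)))

  B : ℕ → Carrier → Carrier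
  B n v = exp (v / 4) * exp (- (π * fromℕ n ^ 2 * exp v))

{-# OPTIONS --safe #-}
-- Write G(t) = exp (p t − γ exp (q t)) with p, q affine of slopes α, β.  Then G′ = k G for
-- k = α − γβ exp (q t), so G″ = (k′ + k²) G, and with γ = π n² both operators collapse to
-- (4 γ² E² − 6 γ E) G, E = exp (q t), which is φₙ once exp (x + y) = exp x · exp y is known.
-- That identity is Mertens' theorem for the exponential series; the derivative of exp at 0 comes
-- from exp h = 1 + h + h² R(h) with R locally bounded, and derivatives are handled through such
-- expansions with a locally bounded second-order remainder.
module Submission where

open import Defs
open import Data.Nat.Base using (ℕ; zero; suc)
open import Data.Product.Base using (_×_; _,_; proj₁; proj₂; ∃-syntax)
open import Data.Sum.Base using (inj₁; inj₂)
open import Data.Integer.Base using (+_)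
open import Function.Base using (_∘_; id; const)
open import Level using (_⊔_)
import Data.Nat.Base as ℕ
import Data.Nat.Properties as ℕ

-- The undecidable order rules out case splits on the signs of `x` and `y`, so arbitrary arguments
-- are replaced by positive bounds `a` and `d` on their sizes. For nonnegative terms the product of
-- two n-th partial sums lies between the n-th and the 2n-th partial sum of the Cauchy product. With
-- the terms of `a` and `d` that Cauchy product is the series of `exp (a + d)`, already known to be
-- Cauchy, and it dominates the error made for `x` and `y`. The formula in `v` is not deduced from
-- the one in `t` by a change of variable. If both slopes α, β are halved and the coefficient `a` of
-- the operator is multiplied by 4, then aα², aαβ and aβ² do not change, and only these three
-- numbers enter the final identity. So a single computation serves both operators.

-- Limits of sequences and domination of series

module Limits {c ℓ₁ ℓ₂} (ℝ : RealNumbers c ℓ₁ ℓ₂) where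

  open RealNumbers ℝ
  open OrderedFieldProperties ℝ
  open Analysis ℝ using (partialSum)
  open import Relation.Binary.Reasoning.Setoid setoid

  private variable
    x y L M ε : Carrier
    s t f u : ℕ → Carrier

  -- Both inequalities are negations, and together they refute `x # y`; tightness of the apartness
  -- turns this into equality.
  ≤-antisym : x ≤ y → y ≤ x → x ≈ y
  ≤-antisym x≤y y≤x = proj₁ (tight _ _) λ where
    (inj₁ x<y) → y≤x x<y
    (inj₂ y<x) → x≤y y<x

  /-pos : ∀ n .{{_ : ℕ.NonZero n}} → 0# < x → 0# < x / n
  /-pos (suc n) 0<x = *-pos 0<x (inv-pos (fromℕ-pos n))

  /2+/2 : ∀ x → x / 2 + x / 2 ≈ x
  /2+/2 x = trans (solve 1 (λ y → y :+ y := y :* con (+ 2)) refl (x / 2)) (/-* x 2)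

  +-pos : 0# < x → 0# < y → 0# < x + y
  +-pos {x} {y} 0<x 0<y = <-trans 0<y (<-by 0<x (solve 2 (λ x y → x := (x :+ y) :- y) refl x y))

  ∣∣<⇒∣∣≤ : ∣ x ∣< ε → ∣ x ∣≤ ε
  ∣∣<⇒∣∣≤ (p , q) = <⇒≤ p , <⇒≤ q

  bounded : ∀ x → ∃[ b ] (0# < b × ∣ x ∣≤ b)
  bounded x = fromℕ (suc (m ℕ.+ n)) , fromℕ-pos (m ℕ.+ n) ,
    ≤-by (≤⇒0≤- (≤-trans (<⇒≤ (proj₂ (archimedean (- x)))) (fromℕ-mono (ℕ.m≤n⇒m≤1+n (ℕ.m≤n+m n m)))))
      (solve 2 (λ x b → b :- (:- x) := x :- (:- b)) refl x _) ,
    ≤-trans (<⇒≤ (proj₂ (archimedean x))) (fromℕ-mono (ℕ.m≤n⇒m≤1+n (ℕ.m≤m+n m n)))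
    where
    m = proj₁ (archimedean x)
    n = proj₁ (archimedean (- x))

  half< : 0# < ε → ε / 2 < ε
  half< {ε} 0<ε = <-by (/-pos 2 0<ε) (begin
    ε / 2                   ≈⟨ solve 1 (λ y → y := (y :+ y) :- y) refl (ε / 2) ⟩
    ε / 2 + ε / 2 - ε / 2   ≈⟨ +-congʳ (/2+/2 ε) ⟩
    ε - ε / 2               ∎)

  -- Weak bounds, unlike the strict ones of _ConvergesTo_, are preserved by the ∣∣≤ calculus.
  _Tends_ : (ℕ → Carrier) → Carrier → Set (c ⊔ ℓ₂)
  s Tends L = ∀ ε → 0# < ε → ∃[ N ] (∀ n → N ℕ.≤ n → ∣ s n - L ∣≤ ε)

  converges-intro : ∀ s L → s Tends L → s ConvergesTo L
  converges-intro s L close ε 0<ε = proj₁ near , λ n N≤n →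
    ∣∣≤⇒∣∣< {ε / 2} {ε} {s n - L} (half< 0<ε) (proj₂ near n N≤n)
    where near = close (ε / 2) (/-pos 2 0<ε)

  converges-elim : ∀ s L → s ConvergesTo L → s Tends L
  converges-elim s L s→L ε 0<ε = proj₁ near , λ n N≤n → ∣∣<⇒∣∣≤ {s n - L} {ε} (proj₂ near n N≤n)
    where near = s→L ε 0<ε

  converges-cong : ∀ s t L → (∀ n → s n ≈ t n) → s ConvergesTo L → t ConvergesTo L
  converges-cong s t L s≈t s→L = converges-intro t L λ ε 0<ε →
    let N , near = converges-elim s L s→L ε 0<ε
    in N , λ n N≤n → ∣∣≤-resp {s n - L} {t n - L} {ε} (+-congʳ (s≈t n)) (near n N≤n)

  converges-const : ∀ x → const x ConvergesTo x
  converges-const x = converges-intro (const x) x λ ε 0<ε → 0 , λ _ _ →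
    ∣∣≤-resp (sym (-‿inverseʳ x)) (∣∣≤-weaken (<⇒≤ 0<ε) (∣∣≤-reflexive (≈⇒≤ refl)))

  converges-suc : ∀ s L → s ConvergesTo L → (s ∘ suc) ConvergesTo L
  converges-suc s L s→L ε 0<ε =
    proj₁ (s→L ε 0<ε) , λ n N≤n → proj₂ (s→L ε 0<ε) (suc n) (ℕ.m≤n⇒m≤1+n N≤n)

  converges-+ : ∀ s t L M → s ConvergesTo L → t ConvergesTo M → (λ n → s n + t n) ConvergesTo (L + M)
  converges-+ s t L M s→L t→M = converges-intro (λ n → s n + t n) (L + M) λ ε 0<ε →
    let N₁ , near₁ = converges-elim s L s→L (ε / 2) (/-pos 2 0<ε)
        N₂ , near₂ = converges-elim t M t→M (ε / 2) (/-pos 2 0<ε)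
    in N₁ ℕ.⊔ N₂ , λ n N≤n →
      ∣∣≤-weaken {ε / 2 + ε / 2} {ε} {s n + t n - (L + M)} (≈⇒≤ (/2+/2 ε))
        (∣∣≤-resp {(s n - L) + (t n - M)} {s n + t n - (L + M)} {ε / 2 + ε / 2}
          (solve 4 (λ s l t m → (s :- l) :+ (t :- m) := (s :+ t) :- (l :+ m)) refl (s n) L (t n) M)
          (∣∣≤-+ {s n - L} {ε / 2} {t n - M} {ε / 2}
            (near₁ n (ℕ.m⊔n≤o⇒m≤o N₁ N₂ N≤n)) (near₂ n (ℕ.m⊔n≤o⇒n≤o N₁ N₂ N≤n))))

  converges-resp : ∀ s L M → L ≈ M → s ConvergesTo L → s ConvergesTo M
  converges-resp s L M L≈M s→L = converges-intro s M λ ε 0<ε →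
    let N , near = converges-elim s L s→L ε 0<ε
    in N , λ n N≤n → ∣∣≤-resp {s n - L} {s n - M} {ε} (+-congˡ (-‿cong L≈M)) (near n N≤n)

  -- The bound on `t` is asked only from `N₂` on, since that is all that convergence of a factor
  -- provides in `converges-*`.
  converges-0* : ∀ s (t : ℕ → Carrier) y N₂ → 0# < y → (∀ n → N₂ ℕ.≤ n → ∣ t n ∣≤ y) →
    s ConvergesTo 0# → (λ n → s n * t n) ConvergesTo 0#
  converges-0* s t y N₂ 0<y t≤y s→0 = converges-intro (λ n → s n * t n) 0# λ ε 0<ε →
    let δ       = ε * inv y (inj₂ 0<y)
        N₁ , s≤ = converges-elim s 0# s→0 δ (*-pos 0<ε (inv-pos 0<y))
    in N₁ ℕ.⊔ N₂ , λ n N≤n →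
      ∣∣≤-weaken {δ * y} {ε} {s n * t n - 0#} (≈⇒≤ (δy≈ε ε))
        (∣∣≤-resp {(s n - 0#) * t n} {s n * t n - 0#} {δ * y}
          (solve 2 (λ s t → (s :- con (+ 0)) :* t := s :* t :- con (+ 0)) refl (s n) (t n))
          (∣∣≤-* {s n - 0#} {δ} {t n} {y}
            (s≤ n (ℕ.m⊔n≤o⇒m≤o N₁ N₂ N≤n)) (t≤y n (ℕ.m⊔n≤o⇒n≤o N₁ N₂ N≤n))))
    where
    δy≈ε : ∀ ε → ε * inv y (inj₂ 0<y) * y ≈ ε
    δy≈ε ε = begin
      ε * inv y (inj₂ 0<y) * y
        ≈⟨ solve 3 (λ e i y → e :* i :* y := e :* (y :* i)) refl ε (inv y (inj₂ 0<y)) y ⟩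
      ε * (y * inv y (inj₂ 0<y))  ≈⟨ *-congˡ (inv-inverseʳ y (inj₂ 0<y)) ⟩
      ε * 1#                      ≈⟨ *-identityʳ ε ⟩
      ε                           ∎

  converges-* : ∀ s t L M → s ConvergesTo L → t ConvergesTo M → (λ n → s n * t n) ConvergesTo (L * M)
  converges-* s t L M s→L t→M = converges-cong _ _ (L * M) expand
    (converges-resp _ _ (L * M) (solve 1 (λ x → con (+ 0) :+ con (+ 0) :+ x := x) refl (L * M))
      (converges-+ _ (const (L * M)) _ (L * M)
        (converges-+ (λ n → (s n - L) * t n) (λ n → (t n - M) * L) 0# 0#
          (converges-0* (λ n → s n - L) t (b + 1#) N (+-pos 0<b 0<1) t≤b+1 (to-0 s L s→L))
          (converges-0* (λ n → t n - M) (const L) d 0 0<d (λ _ _ → L≤d) (to-0 t M t→M)))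
        (converges-const (L * M))))
    where
    b      = proj₁ (bounded M)
    0<b    = proj₁ (proj₂ (bounded M))
    d      = proj₁ (bounded L)
    0<d    = proj₁ (proj₂ (bounded L))
    L≤d    = proj₂ (proj₂ (bounded L))
    N      = proj₁ (converges-elim t M t→M 1# 0<1)

    expand : ∀ n → (s n - L) * t n + (t n - M) * L + L * M ≈ s n * t n
    expand n = solve 4 (λ s l t m → (s :- l) :* t :+ (t :- m) :* l :+ l :* m := s :* t) refl (s n) L (t n) M

    to-0 : ∀ s L → s ConvergesTo L → (λ n → s n - L) ConvergesTo 0#
    to-0 s L s→L = converges-resp (λ n → s n - L) (L - L) 0# (-‿inverseʳ L)
      (converges-+ s (const (- L)) L (- L) s→L (converges-const (- L)))

    -- `N` is the index beyond which `t` stays within 1 of its limit, and `b` bounds that limit.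
    t≤b+1 : ∀ n → N ℕ.≤ n → ∣ t n ∣≤ (b + 1#)
    t≤b+1 n N≤n = ∣∣≤-resp {M + (t n - M)} {t n} {b + 1#}
      (solve 2 (λ t m → m :+ (t :- m) := t) refl (t n) M)
      (∣∣≤-+ {M} {b} {t n - M} {1#} (proj₂ (proj₂ (bounded M)))
        (proj₂ (converges-elim t M t→M 1# 0<1) n N≤n))

  -- If M < L, take η = (L - M) / 2. At an index that serves both sequences, t n < M + η = L - η < s
  -- n, which contradicts s n ≤ t n.
  converges-mono : ∀ s t L M → (∀ n → s n ≤ t n) → s ConvergesTo L → t ConvergesTo M → L ≤ M
  converges-mono s t L M s≤t s→L t→M M<L =
    s≤t n (<-by (+-pos (<⇒0<- (proj₁ (proj₂ s-near n (ℕ.m≤m⊔n _ _))))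
                       (<⇒0<- (proj₂ (proj₂ t-near n (ℕ.m≤n⊔m _ _))))) (begin
      (s n - L - (- η)) + (η - (t n - M))
        ≈⟨ solve 5 (λ s l e t m → (s :- l :- (:- e)) :+ (e :- (t :- m)) :=
           (s :- t) :+ ((e :+ e) :- (l :- m))) refl (s n) L η (t n) M ⟩
      (s n - t n) + ((η + η) - (L - M))
        ≈⟨ +-congˡ (trans (+-congʳ (/2+/2 (L - M))) (-‿inverseʳ (L - M))) ⟩
      (s n - t n) + 0#                       ≈⟨ +-identityʳ _ ⟩
      s n - t n                              ∎))
    where
    η      = (L - M) / 2
    s-near = s→L η (/-pos 2 (<⇒0<- M<L))
    t-near = t→M η (/-pos 2 (<⇒0<- M<L))
    n      = proj₁ s-near ℕ.⊔ proj₁ t-near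

  converges-unique : ∀ s t L M → (∀ n → s n ≈ t n) → s ConvergesTo L → t ConvergesTo M → L ≈ M
  converges-unique s t L M s≈t s→L t→M = ≤-antisym
    (converges-mono s t L M (λ n → ≈⇒≤ (s≈t n)) s→L t→M)
    (converges-mono t s M L (λ n → ≈⇒≤ (sym (s≈t n))) t→M s→L)

  partialSum-cong : (∀ k → f k ≈ u k) → ∀ n → partialSum f n ≈ partialSum u n
  partialSum-cong f≈u zero    = refl
  partialSum-cong f≈u (suc n) = +-cong (partialSum-cong f≈u n) (f≈u n)

  partialSum-nonneg : (∀ k → 0# ≤ f k) → ∀ n → 0# ≤ partialSum f n
  partialSum-nonneg 0≤f zero    = ≈⇒≤ refl
  partialSum-nonneg 0≤f (suc n) = +-nonneg (partialSum-nonneg 0≤f n) (0≤f n)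

  partialSum-suc : ∀ f n → partialSum f (suc n) ≈ f 0 + partialSum (f ∘ suc) n
  partialSum-suc f zero    = +-comm 0# (f 0)
  partialSum-suc f (suc n) = trans (+-congʳ (partialSum-suc f n)) (+-assoc (f 0) _ _)

  partialSum-*ˡ : ∀ x f n → partialSum (λ k → x * f k) n ≈ x * partialSum f n
  partialSum-*ˡ x f zero    = sym (zeroʳ x)
  partialSum-*ˡ x f (suc n) = trans (+-congʳ (partialSum-*ˡ x f n)) (sym (distribˡ x _ _))

  partialSum-bound : (∀ k → ∣ f k ∣≤ u k) → ∀ n → ∣ partialSum f n ∣≤ partialSum u n
  partialSum-bound f≤u zero    = ∣∣≤-reflexive (≈⇒≤ refl)
  partialSum-bound f≤u (suc n) = ∣∣≤-+ (partialSum-bound f≤u n) (f≤u n)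

  partialSum-tail : (∀ k → ∣ f k ∣≤ u k) → ∀ {m n} → m ℕ.≤ n →
    ∣ partialSum f n - partialSum f m ∣≤ (partialSum u n - partialSum u m)
  partialSum-tail {f} {u} f≤u m≤n = go (ℕ.≤⇒≤′ m≤n)
    where
    -- Induction on `≤′` keeps `m` fixed and adds one term at the upper end per step.
    go : ∀ {m n} → m ℕ.≤′ n → ∣ partialSum f n - partialSum f m ∣≤ (partialSum u n - partialSum u m)
    go {m} ℕ.≤′-refl = ∣∣≤-resp (sym (-‿inverseʳ (partialSum f m)))
      (∣∣≤-weaken (≈⇒≤ (sym (-‿inverseʳ (partialSum u m)))) (∣∣≤-reflexive (≈⇒≤ refl)))
    go {m} {suc n} (ℕ.≤′-step m≤n) =
      ∣∣≤-weaken (≈⇒≤ (move (partialSum u n) (partialSum u m) (u n)))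
        (∣∣≤-resp (move (partialSum f n) (partialSum f m) (f n)) (∣∣≤-+ (go m≤n) (f≤u n)))
      where
      move : ∀ x y z → (x - y) + z ≈ (x + z) - y
      move = solve 3 (λ x y z → (x :- y) :+ z := (x :+ z) :- y) refl

  comparison-test : (∀ k → ∣ f k ∣≤ u k) → IsCauchy (partialSum u) → IsCauchy (partialSum f)
  comparison-test {f} {u} f≤u u-cauchy ε 0<ε with u-cauchy ε 0<ε
  ... | N , near = N , close
    where
    close : ∀ m n → N ℕ.≤ m → N ℕ.≤ n → ∣ partialSum f m - partialSum f n ∣< ε
    close m n N≤m N≤n with ℕ.≤-total n m
    ... | inj₁ n≤m = ∣∣≤⇒∣∣< (proj₂ (near m n N≤m N≤n)) (partialSum-tail f≤u n≤m)
    ... | inj₂ m≤n = ∣∣≤⇒∣∣< (proj₂ (near n m N≤n N≤m)) (∣∣≤-resp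
      (solve 2 (λ x y → :- (x :- y) := y :- x) refl (partialSum f n) (partialSum f m))
      (∣∣≤-neg (partialSum-tail f≤u m≤n)))

  converges-neg : ∀ s L → s ConvergesTo L → (λ n → - s n) ConvergesTo (- L)
  converges-neg s L s→L = converges-intro (λ n → - s n) (- L) λ ε 0<ε →
    let N , near = converges-elim s L s→L ε 0<ε
    in N , λ n N≤n → ∣∣≤-resp { - (s n - L)} { - s n - (- L)} {ε}
      (solve 2 (λ s l → :- (s :- l) := :- s :- (:- l)) refl (s n) L)
      (∣∣≤-neg {s n - L} {ε} (near n N≤n))

  converges-bound : ∀ s t L M → (∀ n → ∣ s n ∣≤ t n) → s ConvergesTo L → t ConvergesTo M → ∣ L ∣≤ M
  converges-bound s t L M s≤t s→L t→M =
    converges-mono (λ n → - t n) s (- M) L (λ n → proj₁ (s≤t n)) (converges-neg t M t→M) s→L ,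
    converges-mono s t L M (λ n → proj₂ (s≤t n)) s→L t→M

-- Cauchy products: Leibniz rule and error estimates

module CauchyProduct {c ℓ₁ ℓ₂} (ℝ : RealNumbers c ℓ₁ ℓ₂) where

  open RealNumbers ℝ
  open OrderedFieldProperties ℝ
  open Analysis ℝ using (partialSum)
  open Limits ℝ
  open import Relation.Binary.Reasoning.Setoid setoid

  -- conv f g n = ∑_{i+j=n} f i * g j
  conv : (ℕ → Carrier) → (ℕ → Carrier) → ℕ → Carrier
  conv f g zero    = f 0 * g 0
  conv f g (suc n) = f 0 * g (suc n) + conv (f ∘ suc) g n

  -- On coefficient sequences, differentiation of the generating function.
  ∂ : (ℕ → Carrier) → ℕ → Carrier
  ∂ f k = fromℕ (suc k) * f (suc k)

  conv-cong : ∀ {f f′ g g′} → (∀ k → f k ≈ f′ k) → (∀ k → g k ≈ g′ k) → ∀ n → conv f g n ≈ conv f′ g′ n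
  conv-cong f≈ g≈ zero    = *-cong (f≈ 0) (g≈ 0)
  conv-cong f≈ g≈ (suc n) = +-cong (*-cong (f≈ 0) (g≈ (suc n))) (conv-cong (λ k → f≈ (suc k)) g≈ n)

  conv-+ˡ : ∀ f f′ g n → conv (λ k → f k + f′ k) g n ≈ conv f g n + conv f′ g n
  conv-+ˡ f f′ g zero    = distribʳ (g 0) (f 0) (f′ 0)
  conv-+ˡ f f′ g (suc n) = trans (+-congˡ (conv-+ˡ (f ∘ suc) (f′ ∘ suc) g n))
    (solve 5 (λ a b x p q → (a :+ b) :* x :+ (p :+ q) := (a :* x :+ p) :+ (b :* x :+ q)) refl
      (f 0) (f′ 0) (g (suc n)) (conv (f ∘ suc) g n) (conv (f′ ∘ suc) g n))

  conv-*ˡ : ∀ x f g n → conv (λ k → x * f k) g n ≈ x * conv f g n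
  conv-*ˡ x f g zero    = *-assoc x (f 0) (g 0)
  conv-*ˡ x f g (suc n) = trans (+-cong (*-assoc x (f 0) (g (suc n))) (conv-*ˡ x (f ∘ suc) g n))
    (sym (distribˡ x _ _))

  conv-*ʳ : ∀ x f g n → conv f (λ k → x * g k) n ≈ x * conv f g n
  conv-*ʳ x f g zero    = solve 3 (λ x a b → a :* (x :* b) := x :* (a :* b)) refl x (f 0) (g 0)
  conv-*ʳ x f g (suc n) = trans (+-congˡ (conv-*ʳ x (f ∘ suc) g n))
    (solve 4 (λ x a b p → a :* (x :* b) :+ x :* p := x :* (a :* b :+ p)) refl
      x (f 0) (g (suc n)) (conv (f ∘ suc) g n))

  conv-nonneg : ∀ {f g} → (∀ k → 0# ≤ f k) → (∀ k → 0# ≤ g k) → ∀ n → 0# ≤ conv f g n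
  conv-nonneg 0≤f 0≤g zero    = *-nonneg (0≤f 0) (0≤g 0)
  conv-nonneg 0≤f 0≤g (suc n) =
    +-nonneg (*-nonneg (0≤f 0) (0≤g (suc n))) (conv-nonneg (λ k → 0≤f (suc k)) 0≤g n)

  -- The sum is stated with `fromℕ 1`, which unfolds to `1# + 0#`, because this is the value of the
  -- solver constant `con (+ 1)`.
  fromℕ-suc : ∀ n → fromℕ (suc n) ≈ fromℕ 1 + fromℕ n
  fromℕ-suc n = +-congʳ (sym (+-identityʳ 1#))

  -- Coefficient form of (X g)′ = g + X g′ for g = `f ∘ suc`: apart from its constant term, the
  -- series of `f` is X g.
  ∂-shift : ∀ f k → ∂ f (suc k) ≈ f (suc (suc k)) + ∂ (f ∘ suc) k
  ∂-shift f k = trans (*-congʳ (fromℕ-suc (suc k)))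
    (solve 2 (λ n x → (con (+ 1) :+ n) :* x := x :+ n :* x) refl (fromℕ (suc k)) (f (suc (suc k))))

  -- The Leibniz rule for generating functions, by induction after splitting off the constant term
  -- of `f`.
  ∂-conv : ∀ f g n → ∂ (conv f g) n ≈ conv (∂ f) g n + conv f (∂ g) n
  ∂-conv f g zero    = solve 4
    (λ a a′ b b′ → con (+ 1) :* (a :* b′ :+ a′ :* b) := con (+ 1) :* a′ :* b :+ a :* (con (+ 1) :* b′))
    refl (f 0) (f 1) (g 0) (g 1)
  ∂-conv f g (suc n) = begin
    N⁺ * (a * b′ + (a′ * b + w))
      ≈⟨ *-congʳ (fromℕ-suc (suc n)) ⟩
    (fromℕ 1 + N) * (a * b′ + (a′ * b + w))
      -- `a′ * b + w` is `conv (f ∘ suc) g (suc n)`. Its `N` copies form the left side of the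
      -- induction hypothesis; the one remaining copy is the g of (X g)′ = g + X g′.
      ≈⟨ solve 6 (λ N a b a′ b′ w → (con (+ 1) :+ N) :* (a :* b′ :+ (a′ :* b :+ w)) :=
           (con (+ 1) :* a′ :* b :+ w) :+ a :* ((con (+ 1) :+ N) :* b′) :+ N :* (a′ :* b :+ w)) refl N a b a′ b′ w ⟩
    (fromℕ 1 * a′ * b + w) + a * ((fromℕ 1 + N) * b′) + N * (a′ * b + w)
      ≈⟨ +-cong (+-congˡ (*-congˡ (*-congʳ (sym (fromℕ-suc (suc n)))))) (∂-conv (f ∘ suc) g n) ⟩
    (fromℕ 1 * a′ * b + w) + a * (N⁺ * b′) + (p + q)
      ≈⟨ solve 5 (λ d w e p q → (d :+ w) :+ e :+ (p :+ q) := (d :+ (w :+ p)) :+ (e :+ q)) refl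
           (fromℕ 1 * a′ * b) w (a * (N⁺ * b′)) p q ⟩
    (fromℕ 1 * a′ * b + (w + p)) + (a * (N⁺ * b′) + q)
      ≈⟨ +-congʳ (+-congˡ (conv-+ˡ (f ∘ suc ∘ suc) (∂ (f ∘ suc)) g n)) ⟨
    (fromℕ 1 * a′ * b + conv (λ k → f (suc (suc k)) + ∂ (f ∘ suc) k) g n) + (a * (N⁺ * b′) + q)
      ≈⟨ +-congʳ (+-congˡ (conv-cong (∂-shift f) (λ _ → refl) n)) ⟨
    (fromℕ 1 * a′ * b + conv (∂ f ∘ suc) g n) + (a * (N⁺ * b′) + q) ∎
    where
    N  = fromℕ (suc n)
    N⁺ = fromℕ (suc (suc n))
    a  = f 0
    a′ = f 1
    b  = g (suc n)
    b′ = g (suc (suc n))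
    w  = conv (f ∘ suc ∘ suc) g n
    p  = conv (∂ (f ∘ suc)) g n
    q  = conv (f ∘ suc) (∂ g) n

  -- In the triangle i + j ≤ n the row i = 0 is a full partial sum of `g`; the other rows form the
  -- next smaller triangle for `f ∘ suc`.
  partialSum-conv : ∀ f g n → partialSum (conv f g) (suc n) ≈
    f 0 * partialSum g (suc n) + partialSum (conv (f ∘ suc) g) n
  partialSum-conv f g zero    = solve 2
    (λ a b → con (+ 0) :+ a :* b := a :* (con (+ 0) :+ b) :+ con (+ 0)) refl (f 0) (g 0)
  partialSum-conv f g (suc n) = trans (+-congʳ (partialSum-conv f g n))
    (solve 5 (λ a s b p q → (a :* s :+ p) :+ (a :* b :+ q) := a :* (s :+ b) :+ (p :+ q)) refl
      (f 0) (partialSum g (suc n)) (g (suc n)) (partialSum (conv (f ∘ suc) g) n) (conv (f ∘ suc) g n))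

  -- For `m ≤ n` this is the sum of f i * g j over the part of the rectangle i < m, j < n outside
  -- the triangle i + j < m. The two lengths are independent so that an induction can remove rows
  -- while the columns stay.
  excess : (ℕ → Carrier) → (ℕ → Carrier) → ℕ → ℕ → Carrier
  excess f g m n = partialSum f m * partialSum g n - partialSum (conv f g) m

  -- The row i = 0 meets the region in j = m + 1, ..., n - 1, a block of the series of `g`; the rows
  -- below it form the region for `f ∘ suc`.
  excess-suc : ∀ f g m n → f 0 * (partialSum g n - partialSum g (suc m)) + excess (f ∘ suc) g m n ≈
    excess f g (suc m) n
  excess-suc f g m n = begin
    f 0 * (T - T′) + (S * T - P)
      ≈⟨ solve 5 (λ a t t′ s p → a :* (t :- t′) :+ (s :* t :- p) :=
         (a :+ s) :* t :- (a :* t′ :+ p)) refl (f 0) T T′ S P ⟩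
    (f 0 + S) * T - (f 0 * T′ + P)
      ≈⟨ +-cong (*-congʳ (partialSum-suc f m)) (-‿cong (partialSum-conv f g m)) ⟨
    excess f g (suc m) n              ∎
    where
    S  = partialSum (f ∘ suc) m
    T  = partialSum g n
    T′ = partialSum g (suc m)
    P  = partialSum (conv (f ∘ suc) g) m

  -- Row by row the excess is a sum of products f i * g j without any subtraction left over, so
  -- majorants of the factors give a majorant of the whole.
  excess-bound : ∀ f g u v → (∀ k → ∣ f k ∣≤ u k) → (∀ k → ∣ g k ∣≤ v k) →
    ∀ m n → m ℕ.≤ n → ∣ excess f g m n ∣≤ excess u v m n
  excess-bound f g u v f≤u g≤v zero    n _   = ∣∣≤-resp {0#} (sym (excess-zero f g))
    (∣∣≤-weaken {0#} (≈⇒≤ (sym (excess-zero u v))) (∣∣≤-reflexive (≈⇒≤ refl)))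
    where
    excess-zero : ∀ f g → excess f g 0 n ≈ 0#
    excess-zero f g = solve 1 (λ t → con (+ 0) :* t :- con (+ 0) := con (+ 0)) refl (partialSum g n)
  excess-bound f g u v f≤u g≤v (suc m) n m<n =
    ∣∣≤-weaken (≈⇒≤ (excess-suc u v m n)) (∣∣≤-resp (excess-suc f g m n)
      (∣∣≤-+ {f 0 * (partialSum g n - partialSum g (suc m))} {_} {excess (f ∘ suc) g m n}
        (∣∣≤-* {f 0} {u 0} (f≤u 0) (partialSum-tail g≤v m<n))
        (excess-bound (f ∘ suc) g (u ∘ suc) v (λ k → f≤u (suc k)) g≤v m n (ℕ.≤-trans (ℕ.n≤1+n m) m<n))))

  -- The rectangle i < m, j < n lies inside the triangle i + j < m + n, and the products in between
  -- are nonnegative.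
  partialSum-*-≤ : ∀ u v → (∀ k → 0# ≤ u k) → (∀ k → 0# ≤ v k) →
    ∀ m n → partialSum u m * partialSum v n ≤ partialSum (conv u v) (m ℕ.+ n)
  partialSum-*-≤ u v 0≤u 0≤v zero    n =
    ≤-respˡ (sym (zeroˡ _)) (partialSum-nonneg (conv-nonneg 0≤u 0≤v) n)
  partialSum-*-≤ u v 0≤u 0≤v (suc m) n = ≤-by
    (+-nonneg
      (*-nonneg (0≤u 0) (∣∣≤-nonneg (partialSum-tail {v} {v} (λ k → ∣∣≤-reflexive (0≤v k))
        (ℕ.≤-trans (ℕ.m≤n+m n m) (ℕ.n≤1+n (m ℕ.+ n))))))
      (≤⇒0≤- (partialSum-*-≤ (u ∘ suc) v (λ k → 0≤u (suc k)) 0≤v m n)))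
    (begin
      u 0 * (T′ - T) + (P - S * T)
        ≈⟨ solve 5 (λ a t t′ s p → a :* (t′ :- t) :+ (p :- s :* t) :=
           (a :* t′ :+ p) :- (a :+ s) :* t) refl (u 0) T T′ S P ⟩
      (u 0 * T′ + P) - (u 0 + S) * T
        ≈⟨ +-cong (partialSum-conv u v (m ℕ.+ n)) (-‿cong (*-congʳ (partialSum-suc u m))) ⟨
      partialSum (conv u v) (suc m ℕ.+ n) - partialSum u (suc m) * T  ∎)
    where
    S  = partialSum (u ∘ suc) m
    T  = partialSum v n
    T′ = partialSum v (suc (m ℕ.+ n))
    P  = partialSum (conv (u ∘ suc) v) (m ℕ.+ n)

-- The exponential series: functional equation and quadratic remainder

module Exponential {c ℓ₁ ℓ₂} (ℝ : RealNumbers c ℓ₁ ℓ₂) where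

  open RealNumbers ℝ
  open OrderedFieldProperties ℝ
  open Analysis ℝ hiding (inv; _/_)
  open Limits ℝ
  open CauchyProduct ℝ
  open import Relation.Binary.Reasoning.Setoid setoid

  private variable
    x y b : Carrier

  expSum : Carrier → ℕ → Carrier
  expSum x = partialSum (expTerm x)

  exp-converges : ∀ x → expSum x ConvergesTo exp x
  exp-converges x = proj₂ (complete (expSum x) (exp-cauchy x))

  ^-cong : x ≈ y → ∀ k → x ^ k ≈ y ^ k
  ^-cong x≈y zero    = refl
  ^-cong x≈y (suc k) = *-cong x≈y (^-cong x≈y k)

  /-cong : ∀ n .{{_ : ℕ.NonZero n}} → x ≈ y → x / n ≈ y / n
  /-cong (suc n) x≈y = *-congʳ x≈y

  expTerm-cong : x ≈ y → ∀ k → expTerm x k ≈ expTerm y k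
  expTerm-cong x≈y k = /-cong (k ℕ.!) {{k ℕ.!≢0}} (^-cong x≈y k)

  -- `complete` is not assumed to respect `≈`, so this rests on uniqueness of limits.
  exp-cong : x ≈ y → exp x ≈ exp y
  exp-cong {x} {y} x≈y = converges-unique (expSum x) (expSum y) (exp x) (exp y)
    (partialSum-cong (expTerm-cong x≈y)) (exp-converges x) (exp-converges y)

  expTerm-bound : ∣ x ∣≤ b → ∀ k → ∣ expTerm x k ∣≤ expTerm b k
  expTerm-bound {x} {b} x≤b k = /-bound {x ^ k} {b ^ k} (k ℕ.!) {{k ℕ.!≢0}} (^-bound {x} {b} x≤b k)

  expTerm-nonneg : 0# ≤ x → ∀ k → 0# ≤ expTerm x k
  expTerm-nonneg {x} 0≤x k =
    ∣∣≤-nonneg {expTerm x k} {expTerm x k} (expTerm-bound {x} {x} (∣∣≤-reflexive 0≤x) k)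

  expTerm-zero : ∀ x → expTerm x 0 ≈ 1#
  expTerm-zero x = trans (solve 1 (λ y → y := y :* con (+ 1)) refl (1# / 1)) (/-* 1# 1)

  ∂-expTerm : ∀ x k → ∂ (expTerm x) k ≈ x * expTerm x k
  ∂-expTerm x k = trans (*-comm _ _) (expTerm-suc x k)

  -- A substitute for the binomial theorem: both sides start at 1 and satisfy (n + 1) c (n + 1) = (x
  -- + y) c n, the left one by the Leibniz rule. This is the differential equation E′ = (x + y) E
  -- read off on coefficients.
  conv-expTerm : ∀ x y n → conv (expTerm x) (expTerm y) n ≈ expTerm (x + y) n
  conv-expTerm x y zero    = begin
    expTerm x 0 * expTerm y 0   ≈⟨ *-cong (expTerm-zero x) (expTerm-zero y) ⟩
    1# * 1#                     ≈⟨ *-identityˡ 1# ⟩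
    1#                          ≈⟨ expTerm-zero (x + y) ⟨
    expTerm (x + y) 0           ∎
  conv-expTerm x y (suc n) = *-cancelʳ-fromℕ (suc n) (begin
    conv e f (suc n) * fromℕ (suc n)                 ≈⟨ *-comm _ _ ⟩
    ∂ (conv e f) n                                   ≈⟨ ∂-conv e f n ⟩
    conv (∂ e) f n + conv e (∂ f) n
      ≈⟨ +-cong (conv-cong (∂-expTerm x) (λ _ → refl) n) (conv-cong (λ _ → refl) (∂-expTerm y) n) ⟩
    conv (λ k → x * e k) f n + conv e (λ k → y * f k) n  ≈⟨ +-cong (conv-*ˡ x e f n) (conv-*ʳ y e f n) ⟩
    x * conv e f n + y * conv e f n                  ≈⟨ distribʳ _ x y ⟨
    (x + y) * conv e f n                             ≈⟨ *-congˡ (conv-expTerm x y n) ⟩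
    (x + y) * expTerm (x + y) n                      ≈⟨ expTerm-suc (x + y) n ⟨
    expTerm (x + y) (suc n) * fromℕ (suc n)          ∎)
    where
    e = expTerm x
    f = expTerm y

  exp-+ : ∀ x y → exp (x + y) ≈ exp x * exp y
  exp-+ x y = converges-unique
    (λ n → defect n + expSum (x + y) n) (λ n → expSum x n * expSum y n)
    (exp (x + y)) (exp x * exp y)
    (λ n → solve 2 (λ p s → (p :- s) :+ s := p) refl (expSum x n * expSum y n) (expSum (x + y) n))
    (converges-resp (λ n → defect n + expSum (x + y) n) (0# + exp (x + y)) (exp (x + y)) (+-identityˡ _)
      (converges-+ defect (expSum (x + y)) 0# (exp (x + y)) defect→0 (exp-converges (x + y))))
    (converges-* (expSum x) (expSum y) (exp x) (exp y) (exp-converges x) (exp-converges y))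
    where
    a    = proj₁ (bounded x)
    d    = proj₁ (bounded y)
    x≤a  = proj₂ (proj₂ (bounded x))
    y≤d  = proj₂ (proj₂ (bounded y))
    0≤a  = <⇒≤ (proj₁ (proj₂ (bounded x)))
    0≤d  = <⇒≤ (proj₁ (proj₂ (bounded y)))

    defect : ℕ → Carrier
    defect n = expSum x n * expSum y n - expSum (x + y) n

    excess≈ : ∀ x y m n → excess (expTerm x) (expTerm y) m n ≈ expSum x m * expSum y n - expSum (x + y) m
    excess≈ x y m n = +-congˡ (-‿cong (partialSum-cong (conv-expTerm x y) m))

    -- The excess for `x`, `y` is dominated by the one for `a`, `d`, and that is at most a block of
    -- the series of `exp (a + d)` between n and 2n, which the Cauchy property makes small.
    defect≤ : ∀ n → ∣ defect n ∣≤ (expSum (a + d) (n ℕ.+ n) - expSum (a + d) n)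
    defect≤ n = ∣∣≤-weaken {b = expSum (a + d) (n ℕ.+ n) - expSum (a + d) n} {x = defect n}
      (≤-by (≤⇒0≤- (partialSum-*-≤ (expTerm a) (expTerm d) (expTerm-nonneg 0≤a) (expTerm-nonneg 0≤d) n n))
        (begin
          partialSum (conv (expTerm a) (expTerm d)) (n ℕ.+ n) - p
            ≈⟨ +-congʳ (partialSum-cong (conv-expTerm a d) (n ℕ.+ n)) ⟩
          expSum (a + d) (n ℕ.+ n) - p

              ≈⟨ solve 3 (λ q p s → q :- p :=
                 (q :- s) :- (p :- s)) refl (expSum (a + d) (n ℕ.+ n)) p (expSum (a + d) n) ⟩
          (expSum (a + d) (n ℕ.+ n) - expSum (a + d) n) - (p - expSum (a + d) n)
            ≈⟨ +-congˡ (-‿cong (excess≈ a d n n)) ⟨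
          (expSum (a + d) (n ℕ.+ n) - expSum (a + d) n) - excess (expTerm a) (expTerm d) n n ∎))
      (∣∣≤-resp {excess (expTerm x) (expTerm y) n n} {defect n} (excess≈ x y n n)
        (excess-bound (expTerm x) (expTerm y) (expTerm a) (expTerm d)
          (expTerm-bound x≤a) (expTerm-bound y≤d) n n ℕ.≤-refl))
      where p = expSum a n * expSum d n

    defect→0 : defect ConvergesTo 0#
    defect→0 = converges-intro defect 0# λ ε 0<ε →
      let N , near = exp-cauchy (a + d) ε 0<ε
      in N , λ n N≤n → ∣∣≤-resp {defect n} {defect n - 0#} {ε}
        (solve 1 (λ x → x := x :- con (+ 0)) refl (defect n))
        (∣∣≤-weaken {b = ε} {x = defect n}
          (<⇒≤ (proj₂ (near (n ℕ.+ n) n (ℕ.≤-trans N≤n (ℕ.m≤m+n n n)) N≤n)))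
          (defect≤ n))

  -- expRemainder h = ∑ hᵏ / (k+2)!
  remainderTerm : Carrier → ℕ → Carrier
  remainderTerm h k = expTerm h k / suc k / suc (suc k)

  /-∣∣≤ : ∀ n → ∣ x ∣≤ b → ∣ x / suc n ∣≤ b
  /-∣∣≤ {x} {b} n x≤b = ∣∣≤-weaken {b / suc n} {b} {x / suc n}
    -- After multiplication by n + 1 the difference b - b / (n + 1) becomes b n.
    (≤-by (*-cancelʳ-nonneg {fromℕ (suc n)} {b - b / suc n} (fromℕ-pos n)
      (≤-respʳ (begin
        b * fromℕ n
          ≈⟨ solve 2 (λ b n → b :* n := b :* (con (+ 1) :+ n) :- b) refl b (fromℕ n) ⟩
        b * (fromℕ 1 + fromℕ n) - b
          ≈⟨ +-cong (*-congˡ (fromℕ-suc n)) (-‿cong (/-* b (suc n))) ⟨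
        b * fromℕ (suc n) - b / suc n * fromℕ (suc n)
          ≈⟨ solve 3 (λ b q n → b :* n :- q :* n := (b :- q) :* n) refl b (b / suc n) (fromℕ (suc n)) ⟩
        (b - b / suc n) * fromℕ (suc n)              ∎)
        (*-nonneg (∣∣≤-nonneg {x} {b} x≤b) (fromℕ-nonneg n)))) refl)
    (/-bound {x} {b} (suc n) x≤b)

  remainderTerm-bound : ∣ x ∣≤ b → ∀ k → ∣ remainderTerm x k ∣≤ expTerm b k
  remainderTerm-bound {x} {b} x≤b k = /-∣∣≤ {expTerm x k / suc k} (suc k)
    (/-∣∣≤ {expTerm x k} k (expTerm-bound {x} {b} x≤b k))

  remainder-cauchy : ∀ x → IsCauchy (partialSum (remainderTerm x))
  remainder-cauchy x = comparison-test
    (remainderTerm-bound {x} {proj₁ (bounded x)} (proj₂ (proj₂ (bounded x)))) (exp-cauchy (proj₁ (bounded x)))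

  expRemainder : Carrier → Carrier
  expRemainder x = lim (partialSum (remainderTerm x)) (remainder-cauchy x)

  remainder-converges : ∀ x → partialSum (remainderTerm x) ConvergesTo expRemainder x
  remainder-converges x = proj₂ (complete _ (remainder-cauchy x))

  -- The two extra divisors in each remainder term are at least 1, so the exponential series of `b`
  -- dominates; its bound is uniform over all `x` of size at most `b`.
  expRemainder-bound : ∣ x ∣≤ b → ∣ expRemainder x ∣≤ exp b
  expRemainder-bound {x} {b} x≤b = converges-bound (partialSum (remainderTerm x)) (expSum b) _ _
    (partialSum-bound (remainderTerm-bound {x} {b} x≤b)) (remainder-converges x) (exp-converges b)

  expTerm-remainder : ∀ x k → expTerm x (suc (suc k)) ≈ x * x * remainderTerm x k
  expTerm-remainder x k = *-cancelʳ-fromℕ (suc (suc k)) (*-cancelʳ-fromℕ (suc k) (begin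
    expTerm x (suc (suc k)) * N⁺ * N      ≈⟨ *-congʳ (expTerm-suc x (suc k)) ⟩
    x * expTerm x (suc k) * N             ≈⟨ *-assoc x _ N ⟩
    x * (expTerm x (suc k) * N)           ≈⟨ *-congˡ (expTerm-suc x k) ⟩
    x * (x * expTerm x k)                 ≈⟨ *-congˡ (*-congˡ (/-* (expTerm x k) (suc k))) ⟨
    x * (x * (expTerm x k / suc k * N))
      ≈⟨ *-congˡ (*-congˡ (*-congʳ (/-* (expTerm x k / suc k) (suc (suc k))))) ⟨
    x * (x * (remainderTerm x k * N⁺ * N))
      ≈⟨ solve 4 (λ x r p q → x :* (x :* (r :* p :* q)) :=
         x :* x :* r :* p :* q) refl x (remainderTerm x k) N⁺ N ⟩
    x * x * remainderTerm x k * N⁺ * N    ∎))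
    where
    N  = fromℕ (suc k)
    N⁺ = fromℕ (suc (suc k))

  expTerm-one : ∀ x → expTerm x 1 ≈ x
  expTerm-one x = begin
    expTerm x 1             ≈⟨ solve 1 (λ y → y := y :* con (+ 1)) refl (expTerm x 1) ⟩
    expTerm x 1 * fromℕ 1   ≈⟨ expTerm-suc x 0 ⟩
    x * expTerm x 0         ≈⟨ *-congˡ (expTerm-zero x) ⟩
    x * 1#                  ≈⟨ *-identityʳ x ⟩
    x                       ∎

  expSum-remainder : ∀ x n → expSum x (suc (suc n)) ≈ 1# + x + x * x * partialSum (remainderTerm x) n
  expSum-remainder x n = begin
    expSum x (suc (suc n))
      ≈⟨ partialSum-suc (expTerm x) (suc n) ⟩
    expTerm x 0 + partialSum (expTerm x ∘ suc) (suc n)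
      ≈⟨ +-cong (expTerm-zero x) (partialSum-suc (expTerm x ∘ suc) n) ⟩
    1# + (expTerm x 1 + partialSum (λ k → expTerm x (suc (suc k))) n)
      ≈⟨ +-congˡ (+-cong (expTerm-one x) (partialSum-cong (expTerm-remainder x) n)) ⟩
    1# + (x + partialSum (λ k → x * x * remainderTerm x k) n)
      ≈⟨ +-assoc 1# x _ ⟨
    1# + x + partialSum (λ k → x * x * remainderTerm x k) n
      ≈⟨ +-congˡ (partialSum-*ˡ (x * x) (remainderTerm x) n) ⟩
    1# + x + x * x * partialSum (remainderTerm x) n ∎

  exp-expansion : ∀ x → exp x ≈ 1# + x + x * x * expRemainder x
  exp-expansion x = converges-unique
    (λ n → expSum x (suc (suc n))) (λ n → 1# + x + x * x * partialSum (remainderTerm x) n) _ _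
    (expSum-remainder x)
    (converges-suc (λ n → expSum x (suc n)) (exp x) (converges-suc (expSum x) (exp x) (exp-converges x)))
    (converges-+ (const (1# + x)) (λ n → x * x * partialSum (remainderTerm x) n) (1# + x) (x * x * expRemainder x)
      (converges-const (1# + x))
      (converges-* (const (x * x)) (partialSum (remainderTerm x)) (x * x) (expRemainder x)
        (converges-const (x * x)) (remainder-converges x)))

-- Second-order expansions and derivatives

module Calculus {c ℓ₁ ℓ₂} (ℝ : RealNumbers c ℓ₁ ℓ₂) where

  open RealNumbers ℝ
  open OrderedFieldProperties ℝ
  open Analysis ℝ hiding (inv; _/_)
  open Limits ℝ
  open Exponential ℝ
  open import Relation.Binary.Reasoning.Setoid setoid

  -- Bounds are required on every ball, not just on some ball around 0: in a composite the outer
  -- remainder is evaluated at an inner increment whose size is not under control beforehand.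
  LocallyBounded : (Carrier → Carrier) → Set (c ⊔ ℓ₂)
  LocallyBounded r = ∀ B → ∃[ M ] (∀ h → ∣ h ∣≤ B → ∣ r h ∣≤ M)

  bounded-const : ∀ x → LocallyBounded (const x)
  bounded-const x B = proj₁ (bounded x) , λ _ _ → proj₂ (proj₂ (bounded x))

  bounded-id : LocallyBounded id
  bounded-id B = B , λ _ h≤B → h≤B

  bounded-+ : ∀ r s → LocallyBounded r → LocallyBounded s → LocallyBounded (λ h → r h + s h)
  bounded-+ r s r-bdd s-bdd B = proj₁ (r-bdd B) + proj₁ (s-bdd B) , λ h h≤B →
    ∣∣≤-+ {r h} {_} {s h} (proj₂ (r-bdd B) h h≤B) (proj₂ (s-bdd B) h h≤B)

  bounded-* : ∀ r s → LocallyBounded r → LocallyBounded s → LocallyBounded (λ h → r h * s h)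
  bounded-* r s r-bdd s-bdd B = proj₁ (r-bdd B) * proj₁ (s-bdd B) , λ h h≤B →
    ∣∣≤-* {r h} {_} {s h} (proj₂ (r-bdd B) h h≤B) (proj₂ (s-bdd B) h h≤B)

  bounded-∘ : ∀ r s → LocallyBounded r → LocallyBounded s → LocallyBounded (r ∘ s)
  bounded-∘ r s r-bdd s-bdd B =
    let C , s≤C = s-bdd B
        M , r≤M = r-bdd C
    in M , λ h h≤B → r≤M (s h) (s≤C h h≤B)

  bounded-exp-remainder : LocallyBounded expRemainder
  bounded-exp-remainder B = exp B , λ h → expRemainder-bound {h} {B}

  -- Unlike the difference quotient, this form makes sense at h = 0, so the chain rule does
  -- not need the inner increment to be apart from 0.
  Expands : (Carrier → Carrier) → Carrier → Carrier → Set (c ⊔ ℓ₁ ⊔ ℓ₂)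
  Expands f x L = ∃[ r ] (LocallyBounded r × (∀ h → f (x + h) ≈ f x + L * h + h * h * r h))

  expands-resp : ∀ f x L M → L ≈ M → Expands f x L → Expands f x M
  expands-resp f x L M L≈M (r , r-bdd , f≈) =
    r , r-bdd , λ h → trans (f≈ h) (+-congʳ (+-congˡ (*-congʳ L≈M)))

  expands-affine : ∀ p α → (∀ x h → p (x + h) ≈ p x + α * h) → ∀ x → Expands p x α
  expands-affine p α p≈ x = const 0# , bounded-const 0# ,
    λ h → trans (p≈ x h)
      (solve 3 (λ p a h → p :+ a :* h := p :+ a :* h :+ h :* h :* con (+ 0)) refl (p x) α h)

  expands-* : ∀ f g x L M → Expands f x L → Expands g x M →
    Expands (λ y → f y * g y) x (L * g x + f x * M)
  expands-* f g x L M (r , r-bdd , f≈) (s , s-bdd , g≈) =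
    (λ h → (L + h * r h) * (M + h * s h) + (f x * s h + g x * r h)) ,
    bounded-+ _ _
      (bounded-* _ _ (incr L r r-bdd) (incr M s s-bdd))
      (bounded-+ _ _ (bounded-* _ s (bounded-const (f x)) s-bdd) (bounded-* _ r (bounded-const (g x)) r-bdd)) ,
    λ h → trans (*-cong (f≈ h) (g≈ h))
      (solve 7 (λ f g l m h r s →
        (f :+ l :* h :+ h :* h :* r) :* (g :+ m :* h :+ h :* h :* s) :=
        f :* g :+ (l :* g :+ f :* m) :* h :+
          h :* h :* ((l :+ h :* r) :* (m :+ h :* s) :+ (f :* s :+ g :* r))) refl (f x) (g x) L M h (r h) (s h))
    where
    incr : ∀ L r → LocallyBounded r → LocallyBounded (λ h → L + h * r h)
    incr L r r-bdd = bounded-+ (const L) (λ h → h * r h) (bounded-const L) (bounded-* id r bounded-id r-bdd)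

  expands-∘ : ∀ f g x L M → (∀ {y z} → y ≈ z → f y ≈ f z) →
    Expands f (g x) L → Expands g x M → Expands (f ∘ g) x (L * M)
  expands-∘ f g x L M f-cong (r , r-bdd , f≈) (s , s-bdd , g≈) =
    -- The inner increment is h * q h. Its part beyond h * M contributes L * s h, and the outer
    -- remainder carries the factor (h * q h)².
    (λ h → L * s h + q h * q h * r (h * q h)) ,
    bounded-+ _ _ (bounded-* _ s (bounded-const L) s-bdd)
      (bounded-* _ _ (bounded-* q q q-bdd q-bdd) (bounded-∘ r _ r-bdd (bounded-* id q bounded-id q-bdd))) ,
    λ h → begin
      f (g (x + h))

          ≈⟨ f-cong (trans (g≈ h) (solve 4 (λ g m h s → g :+ m :* h :+ h :* h :* s :=
             g :+ h :* (m :+ h :* s)) refl (g x) M h (s h))) ⟩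
      f (g x + h * q h)
        ≈⟨ f≈ (h * q h) ⟩
      f (g x) + L * (h * q h) + h * q h * (h * q h) * r (h * q h)

          ≈⟨ solve 6 (λ f l m h s r → f :+ l :* (h :* (m :+ h :* s)) :+ h :* (m :+ h :* s) :* (h :* (m :+ h :* s)) :* r :=
             f :+ l :* m :* h :+ h :* h :* (l :* s :+ (m :+ h :* s) :* (m :+ h :* s) :* r))
             refl (f (g x)) L M h (s h) (r (h * q h)) ⟩
      f (g x) + L * M * h + h * h * (L * s h + q h * q h * r (h * q h)) ∎
    where
    q : Carrier → Carrier
    q h = M + h * s h
    q-bdd : LocallyBounded q
    q-bdd = bounded-+ (const M) _ (bounded-const M) (bounded-* id s bounded-id s-bdd)

  -- The functional equation carries the expansion at 0 to every point.
  expands-exp : ∀ x → Expands exp x (exp x)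
  expands-exp x = (λ h → exp x * expRemainder h) ,
    bounded-* (const (exp x)) expRemainder (bounded-const (exp x)) bounded-exp-remainder ,
    λ h → begin
      exp (x + h)                                     ≈⟨ exp-+ x h ⟩
      exp x * exp h                                   ≈⟨ *-congˡ (exp-expansion h) ⟩
      exp x * (1# + h + h * h * expRemainder h)
        ≈⟨ solve 4 (λ e o h r → e :* (o :+ h :+ h :* h :* r) :=
           e :* o :+ e :* h :+ h :* h :* (e :* r)) refl (exp x) 1# h (expRemainder h) ⟩
      exp x * 1# + exp x * h + h * h * (exp x * expRemainder h)  ≈⟨ +-congʳ (+-congʳ (*-identityʳ (exp x))) ⟩
      exp x + exp x * h + h * h * (exp x * expRemainder h)       ∎

  -- The difference quotient misses `L` by exactly h * r h.
  expands⇒derivative : ∀ f x L → Expands f x L → HasDerivativeAt f x L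
  expands⇒derivative f x L (r , r-bdd , f≈) ε 0<ε = δ , 0<δ , λ h h#0 h<δ →
    ∣∣≤⇒∣∣< {δ * M} {ε} {(f (x + h) - f x) * inv h h#0 - L} δM<ε
      (∣∣≤-resp {h * r h} {(f (x + h) - f x) * inv h h#0 - L} {δ * M} (quotient h h#0)
        (∣∣≤-* {h} {δ} {r h} {M} (∣∣<⇒∣∣≤ {h} {δ} h<δ)
          (proj₂ (r-bdd 1#) h (∣∣≤-weaken {δ} {1#} {h} δ≤1 (∣∣<⇒∣∣≤ {h} {δ} h<δ)))))
    where
    M = proj₁ (r-bdd 1#)
    K = fromℕ (proj₁ (archimedean M))

    0<ε+K : 0# < ε + K
    0<ε+K = <-≤-trans 0<ε (≤-by (fromℕ-nonneg (proj₁ (archimedean M)))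
      (solve 2 (λ e k → k := (e :+ k) :- e) refl ε K))

    i = inv (ε + K) (inj₂ 0<ε+K)
    -- δ = ε / (ε + K) for a natural number K > M: it is at most 1, so the bound `M` on the unit
    -- ball applies, and δ * M < ε. No minimum of two radii is needed, and ε + K is visibly
    -- positive.
    δ = ε * i

    0<δ : 0# < δ
    0<δ = *-pos 0<ε (inv-pos 0<ε+K)

    δ≤1 : δ ≤ 1#
    δ≤1 = ≤-by (*-nonneg (fromℕ-nonneg (proj₁ (archimedean M))) (<⇒≤ (inv-pos 0<ε+K))) (begin
      K * i                  ≈⟨ solve 3 (λ e k i → k :* i := (e :+ k) :* i :- e :* i) refl ε K i ⟩
      (ε + K) * i - δ        ≈⟨ +-congʳ (inv-inverseʳ (ε + K) (inj₂ 0<ε+K)) ⟩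
      1# - δ                 ∎)

    δM<ε : δ * M < ε
    δM<ε = <-by (*-pos 0<δ (+-pos 0<ε (<⇒0<- (proj₂ (archimedean M))))) (begin
      δ * (ε + (K - M))
        ≈⟨ solve 4 (λ e k i m → e :* i :* (e :+ (k :- m)) :=
           e :* ((e :+ k) :* i) :- e :* i :* m) refl ε K i M ⟩
      ε * ((ε + K) * i) - δ * M
        ≈⟨ +-congʳ (trans (*-congˡ (inv-inverseʳ (ε + K) (inj₂ 0<ε+K))) (*-identityʳ ε)) ⟩
      ε - δ * M                    ∎)

    quotient : ∀ h h#0 → h * r h ≈ (f (x + h) - f x) * inv h h#0 - L
    quotient h h#0 = sym (begin
      (f (x + h) - f x) * h⁻¹ - L                       ≈⟨ +-congʳ (*-congʳ (+-congʳ (f≈ h))) ⟩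
      (f x + L * h + h * h * r h - f x) * h⁻¹ - L
        ≈⟨ solve 5 (λ f l h r i → (f :+ l :* h :+ h :* h :* r :- f) :* i :- l :=
           (l :+ h :* r) :* (h :* i) :- l) refl (f x) L h (r h) h⁻¹ ⟩
      (L + h * r h) * (h * h⁻¹) - L
        ≈⟨ +-congʳ (trans (*-congˡ (inv-inverseʳ h h#0)) (*-identityʳ _)) ⟩
      L + h * r h - L
        ≈⟨ solve 2 (λ l y → l :+ y :- l := y) refl L (h * r h) ⟩
      h * r h                                           ∎)
      where h⁻¹ = inv h h#0

-- Derivatives of the double exponential and the theta modes

module ModeDerivatives {c ℓ₁ ℓ₂} (ℝ : RealNumbers c ℓ₁ ℓ₂) where

  open RealNumbers ℝ
  open OrderedFieldProperties ℝ
  open Analysis ℝ hiding (inv; _/_)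
  open ThetaModes ℝ
  open Limits ℝ
  open Exponential ℝ
  open Calculus ℝ
  open import Relation.Binary.Reasoning.Setoid setoid

  module DoubleExponential (γ : Carrier) (p q : Carrier → Carrier) (α β : Carrier)
    (p-affine : ∀ x h → p (x + h) ≈ p x + α * h)
    (q-affine : ∀ x h → q (x + h) ≈ q x + β * h) where

    F : Carrier → Carrier
    F t = exp (p t) * exp (- (γ * exp (q t)))

    -- F′ = k F
    k : Carrier → Carrier
    k t = α - γ * β * exp (q t)

    k′ : Carrier → Carrier
    k′ t = - (γ * β) * (exp (q t) * β)

    expands-exp∘ : ∀ r ρ x → Expands r x ρ → Expands (exp ∘ r) x (exp (r x) * ρ)
    expands-exp∘ r ρ x = expands-∘ exp r x (exp (r x)) ρ exp-cong (expands-exp (r x))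

    expands-exp-q : ∀ x → Expands (exp ∘ q) x (exp (q x) * β)
    expands-exp-q x = expands-exp∘ q β x (expands-affine q β q-affine x)

    expands-F : ∀ x → Expands F x (k x * F x)
    expands-F x = expands-resp F x _ (k x * F x)
      (solve 6 (λ e a g c b E → e :* a :* g :+ e :* (g :* (:- c :* (E :* b))) :=
                                (a :- c :* b :* E) :* (e :* g)) refl
        (exp (p x)) α (exp (- (γ * exp (q x)))) γ β (exp (q x)))
      (expands-* (exp ∘ p) (λ y → exp (- (γ * exp (q y)))) x _ _
        (expands-exp∘ p α x (expands-affine p α p-affine x))
        (expands-exp∘ (λ y → - (γ * exp (q y))) (- γ * (exp (q x) * β)) x
          (expands-∘ (λ y → - (γ * y)) (exp ∘ q) x (- γ) (exp (q x) * β)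
            (λ y≈z → -‿cong (*-congˡ y≈z))
            (expands-affine (λ y → - (γ * y)) (- γ)
              (solve 3 (λ c x h → :- (c :* (x :+ h)) := :- (c :* x) :+ :- c :* h) refl γ) (exp (q x)))
            (expands-exp-q x))))

    expands-k : ∀ x → Expands k x (k′ x)
    expands-k x = expands-∘ (λ y → α - γ * β * y) (exp ∘ q) x (- (γ * β)) (exp (q x) * β)
      (λ y≈z → +-congˡ (-‿cong (*-congˡ y≈z)))
      (expands-affine (λ y → α - γ * β * y) (- (γ * β))
        (solve 4 (λ a d x h → a :- d :* (x :+ h) := (a :- d :* x) :+ :- d :* h) refl α (γ * β)) (exp (q x)))
      (expands-exp-q x)

    F″ : Carrier → Carrier
    F″ x = k′ x * F x + k x * (k x * F x)

    secondDerivative : ∀ x → HasSecondDerivativeAt F x (F″ x)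
    secondDerivative x = (λ y → k y * F y) ,
      (λ y → expands⇒derivative F y (k y * F y) (expands-F y)) ,
      expands⇒derivative (λ y → k y * F y) x (F″ x)
        (expands-* k F x (k′ x) (k x * F x) (expands-k x) (expands-F x))

  -- The theta mode as a polynomial in e and E times the Gaussian factor, with e and E in place of
  -- e^{t/2} and e^{2t}; both operators lead to this form.
  mode : ℕ → Carrier → Carrier → Carrier
  mode n e E =
    fromℕ 2 * ( fromℕ 2 * π ^ 2 * fromℕ n ^ 4 * (e * (E * E))
              - fromℕ 3 * π * fromℕ n ^ 2 * (e * E))
            * exp (- (π * fromℕ n ^ 2 * E))

  mode-cong : ∀ n {e e′ E E′} → e ≈ e′ → E ≈ E′ → mode n e E ≈ mode n e′ E′
  mode-cong n e≈e′ E≈E′ = *-cong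
    (*-congˡ (+-cong (*-congˡ (*-cong e≈e′ (*-cong E≈E′ E≈E′))) (-‿cong (*-congˡ (*-cong e≈e′ E≈E′)))))
    (exp-cong (-‿cong (*-congˡ E≈E′)))

  -- Both choices (a, α, β) = (1, 1/2, 2) and (4, 1/4, 1) of the lemma satisfy these relations.
  module _ (n : ℕ) (p q : Carrier → Carrier) (a α β κ : Carrier)
    (p-affine : ∀ x h → p (x + h) ≈ p x + α * h)
    (q-affine : ∀ x h → q (x + h) ≈ q x + β * h)
    (aα²≈κ : a * α * α ≈ κ) (aαβ≈1 : a * α * β ≈ 1#) (aβ²≈4 : a * β * β ≈ fromℕ 4) where

    open DoubleExponential (π * fromℕ n ^ 2) p q α β p-affine q-affine

    -- a (k′ + k²) = aα² - (2 aαβ + aβ²) γE + aβ² γ²E². The relations cancel aα² against κ and leave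
    -- 4γ²E² - 6γE.
    mode-identity : ∀ t → mode n (exp (p t)) (exp (q t)) ≈ a * F″ t - κ * F t
    mode-identity t = sym (begin
      a * (- (γ * β) * (E * β) * f + (α - γ * β * E) * ((α - γ * β * E) * f)) - κ * f
        ≈⟨ solve 7 (λ a α β κ γ E f →
             a :* (:- (γ :* β) :* (E :* β) :* f :+ (α :- γ :* β :* E) :* ((α :- γ :* β :* E) :* f)) :- κ :* f :=
             (a :* α :* α :- κ) :* f :+ (a :* β :* β :* (γ :* γ :* E :* E :- γ :* E)
               :- con (+ 2) :* (a :* α :* β :* (γ :* E))) :* f) refl a α β κ γ E f ⟩
      (a * α * α - κ) * f + (a * β * β * (γ * γ * E * E - γ * E) - fromℕ 2 * (a * α * β * (γ * E))) * f
        ≈⟨ +-cong (*-congʳ (trans (+-congʳ aα²≈κ) (-‿inverseʳ κ)))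
             (*-congʳ (+-cong (*-congʳ aβ²≈4) (-‿cong (*-congˡ (trans (*-congʳ aαβ≈1) (*-identityˡ _)))))) ⟩
      0# * f + (fromℕ 4 * (γ * γ * E * E - γ * E) - fromℕ 2 * (γ * E)) * f
        -- The variable `o` stands for the `1#` that ends each unfolded power; it has the same
        -- degree in matching terms of both sides, so the identity holds with `o` left arbitrary.
        ≈⟨ solve 6 (λ P N o e E g →
             let n² = N :* (N :* o)
                 γ  = P :* n²
             in con (+ 0) :* (e :* g) :+ (con (+ 4) :* (γ :* γ :* E :* E :- γ :* E) :- con (+ 2) :* (γ :* E)) :* (e :* g) :=
                con (+ 2) :* (con (+ 2) :* (P :* (P :* o)) :* (N :* (N :* n²)) :* (e :* (E :* E))
                              :- con (+ 3) :* P :* n² :* (e :* E)) :* g) refl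
             π (fromℕ n) 1# (exp (p t)) E (exp (- (γ * E))) ⟩
      mode n (exp (p t)) E ∎)
      where
      γ = π * fromℕ n ^ 2
      E = exp (q t)
      f = F t

    mode-second-order : ∀ t y → y ≈ mode n (exp (p t)) (exp (q t)) → ⟨ a ∂²− κ ⟩ F at t ↦ y
    mode-second-order t y y≈ = F″ t , secondDerivative t , trans y≈ (mode-identity t)

  -- The exponents split as 5/2 = 1/2 + 2 and 9/2 = 1/2 + 2 + 2; the functional equation does the
  -- rest.
  φ≈mode : ∀ n t → φ n t ≈ mode n (exp (t / 2)) (exp (fromℕ 2 * t))
  φ≈mode n t = *-congʳ (*-congˡ (+-cong (*-congˡ exp-9/2) (-‿cong (*-congˡ exp-5/2))))
    where
    y = t / 2
    d = fromℕ 2 * t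

    d≈4y : d ≈ fromℕ 4 * y
    d≈4y = trans (*-congˡ (sym (/2+/2 t)))
      (solve 1 (λ y → con (+ 2) :* (y :+ y) := con (+ 4) :* y) refl y)

    exp-5/2 : exp (fromℕ 5 * t / 2) ≈ exp y * exp d
    exp-5/2 = trans (exp-cong (begin
      fromℕ 5 * t / 2      ≈⟨ *-assoc (fromℕ 5) t _ ⟩
      fromℕ 5 * y          ≈⟨ solve 1 (λ y → con (+ 5) :* y := y :+ con (+ 4) :* y) refl y ⟩
      y + fromℕ 4 * y      ≈⟨ +-congˡ d≈4y ⟨
      y + d                ∎)) (exp-+ y d)

    exp-9/2 : exp (fromℕ 9 * t / 2) ≈ exp y * (exp d * exp d)
    exp-9/2 = trans (exp-cong (begin
      fromℕ 9 * t / 2                  ≈⟨ *-assoc (fromℕ 9) t _ ⟩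
      fromℕ 9 * y
        ≈⟨ solve 1 (λ y → con (+ 9) :* y := y :+ (con (+ 4) :* y :+ con (+ 4) :* y)) refl y ⟩
      y + (fromℕ 4 * y + fromℕ 4 * y)  ≈⟨ +-congˡ (+-cong d≈4y d≈4y) ⟨
      y + (d + d)                      ∎))
      (trans (exp-+ y (d + d)) (*-congˡ (exp-+ d d)))

  /-affine : ∀ n .{{_ : ℕ.NonZero n}} x h → (x + h) / n ≈ x / n + 1# / n * h
  /-affine (suc n) x h = trans
    (solve 3 (λ x h i → (x :+ h) :* i := x :* i :+ i :* h) refl x h (inv (fromℕ (suc n)) (inj₂ (fromℕ-pos n))))
    (+-congˡ (*-congʳ (sym (*-identityˡ _))))

  /2/2≈/4 : ∀ x → x / 2 / 2 ≈ x / 4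
  /2/2≈/4 x = *-cancelʳ-fromℕ 4 (begin
    x / 2 / 2 * fromℕ 4
      ≈⟨ solve 1 (λ y → y :* con (+ 4) := y :* con (+ 2) :* con (+ 2)) refl (x / 2 / 2) ⟩
    x / 2 / 2 * fromℕ 2 * fromℕ 2    ≈⟨ *-congʳ (/-* (x / 2) 2) ⟩
    x / 2 * fromℕ 2                  ≈⟨ /-* x 2 ⟩
    x                                ≈⟨ /-* x 4 ⟨
    x / 4 * fromℕ 4                  ∎)

  b-second-order : ∀ n t → ⟨ 1# ∂²− 1# / 4 ⟩ (b n) at t ↦ φ n t
  b-second-order n t = mode-second-order n (_/ 2) (fromℕ 2 *_) 1# (1# / 2) (fromℕ 2) (1# / 4)
    (/-affine 2) (distribˡ (fromℕ 2))
    (begin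
      1# * (1# / 2) * (1# / 2)      ≈⟨ *-congʳ (*-identityˡ (1# / 2)) ⟩
      1# / 2 * (1# / 2)             ≈⟨ *-assoc (1# / 2) 1# _ ⟨
      1# / 2 * 1# / 2               ≈⟨ *-congʳ (*-identityʳ (1# / 2)) ⟩
      1# / 2 / 2                    ≈⟨ /2/2≈/4 1# ⟩
      1# / 4                        ∎)
    (trans (*-congʳ (*-identityˡ (1# / 2))) (/-* 1# 2))
    (trans (*-congʳ (*-identityˡ (fromℕ 2))) (solve 0 (con (+ 2) :* con (+ 2) := con (+ 4)) refl))
    t (φ n t) (φ≈mode n t)

  B-second-order : ∀ n v → ⟨ fromℕ 4 ∂²− 1# / 4 ⟩ (B n) at v ↦ φ n (v / 2)
  B-second-order n v = mode-second-order n (_/ 4) id (fromℕ 4) (1# / 4) 1# (1# / 4)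
    (/-affine 4) (λ x h → +-congˡ (sym (*-identityˡ h)))
    (trans (*-congʳ 4·¼≈1) (*-identityˡ (1# / 4)))
    (trans (*-identityʳ _) 4·¼≈1)
    (trans (*-identityʳ _) (*-identityʳ (fromℕ 4)))
    v (φ n (v / 2))
    (trans (φ≈mode n (v / 2)) (mode-cong n (exp-cong (/2/2≈/4 v))
      (exp-cong (trans (*-comm (fromℕ 2) (v / 2)) (/-* v 2)))))
    where
    4·¼≈1 : fromℕ 4 * (1# / 4) ≈ 1#
    4·¼≈1 = trans (*-comm (fromℕ 4) (1# / 4)) (/-* 1# 4)

lemma10p1 : ∀ {c ℓ₁ ℓ₂} (ℝ : RealNumbers c ℓ₁ ℓ₂) →
  let open RealNumbers ℝ
      open Analysis ℝ
      open ThetaModes ℝ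
  in ∀ (n : ℕ) → 1 ℕ.≤ n →
     (∀ t → 0# ≤ t → ⟨ 1# ∂²− 1# / 4 ⟩ (b n) at t ↦ φ n t)
   × (∀ v → 0# ≤ v → ⟨ fromℕ 4 ∂²− 1# / 4 ⟩ (B n) at v ↦ φ n (v / 2))
lemma10p1 ℝ n _ = (λ t _ → b-second-order n t) , (λ v _ → B-second-order n v)
  where open ModeDerivatives ℝ
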